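{- Let $\Gamma$ be a finite group and let $\mathrm{Cay}(\Gamma,S)$ be a normal mixed Cayley graph. Then $\mathrm{Cay}(\Gamma,S)$ is Eisenstein integral if and only if it is HS-integral.
   Context: Let $\Gamma$ be a finite group with identity $\mathbf 1$ and $S\subseteq\Gamma$ with $\mathbf 1\notin S$. The mixed Cayley graph $G=\mathrm{Cay}(\Gamma,S)$ has vertex set $\Gamma$ and edge set $E=\{(a,b): a,b\in\Gamma,\ ba^{ -1}\in S\}$ (a set of ordered pairs). It is called normal if $S$ is a union of conjugacy classes of $\Gamma$. The $(0,1)$-adjacency matrix $\mathcal A(G)=(a_{uv})$ has $a_{uv}=1$ if $(u,v)\in E$ and $a_{uv}=0$ otherwise. The Hermitian-adjacency matrix of the second kind $\mathcal H(G)=(h_{uv})$ has $h_{uv}=1$ if $(u,v)\in E$ and $(v,u)\in E$; $h_{uv}=\frac{1+i\sqrt3}{2}$ if $(u,v)\in E$ and $(v,u)\notin E$; $h_{uv}=\frac{1-i\sqrt3}{2}$ if $(u,v)\notin E$ and $(v,u)\in E$; and $h_{uv}=0$ otherwise. $G$ is HS-integral if all eigenvalues of $\mathcal H(G)$ are integers. $G$ is Eisenstein integral if all eigenvalues of $\mathcal A(G)$ are Eisenstein integers, i.e. of the form $a+b\omega_3$ with $a,b\in\mathbb Z$, where $\omega_3=\exp(2\pi i/3)$. -}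

module Defs where

open import Level using (Level; _⊔_; suc)
open import Algebra.Apartness.Bundles using (HeytingField)
open import Algebra.Bundles using (Group; CommutativeRing)
open import Data.Bool.Base using (Bool; true; false; if_then_else_)
open import Data.Fin.Base using (Fin; toℕ)
open import Data.Integer.Base using (ℤ; +_; -[1+_])
open import Data.Nat.Base using (ℕ) renaming (suc to sucℕ)
open import Data.Product.Base using (_×_; _,_; proj₁; ∃-syntax; Σ-syntax)
open import Data.Vec.Functional using (Vector)
open import Function.Bundles using (Inverse; _⇔_)
open import Relation.Binary.Bundles using (Setoid)
open import Relation.Binary.Core using (Rel)
open import Relation.Binary.Definitions using (_Respects_; _Respects₂_)
  renaming (Decidable to Decidable₂)
open import Relation.Binary.PropositionalEquality.Properties using ()
  renaming (setoid to ≡-setoid)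
open import Relation.Nullary.Decidable.Core using (does)
open import Relation.Nullary.Negation.Core using (¬_)
open import Relation.Unary using (Pred; Decidable)
import Algebra.Properties.Semiring.Exp as Exp
import Algebra.Properties.Semiring.Mult as Mult
import Algebra.Properties.Semiring.Sum as Sum

-- The standard library has no ℂ, so eigenvalues live in an arbitrary
-- algebraically closed field of characteristic 0 with a chosen square
-- root i of -1 and a chosen square root √3 of 3; ℂ is the intended
-- instance.  Equality is not assumed decidable, since it is not for
-- constructive models of ℂ; "nonzero" is expressed by apartness.

record ComplexField c ℓ₁ ℓ₂ : Set (suc (c ⊔ ℓ₁ ⊔ ℓ₂)) where
  field
    heytingField : HeytingField c ℓ₁ ℓ₂

  open HeytingField heytingField public

  commutativeRing : CommutativeRing c ℓ₁
  commutativeRing = record { isCommutativeRing = isCommutativeRing }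

  open CommutativeRing commutativeRing public using (semiring)
  open Exp semiring public using (_^_)
  open Mult semiring public using () renaming (_×_ to _·_)
  open Sum semiring public using (sum-syntax)

  field
    characteristic-0 : ∀ n → sucℕ n · 1# # 0#

    -- Every monic polynomial xᵈ⁺¹ + a_d xᵈ + … + a₀ has a root.
    algebraicallyClosed : ∀ d (a : Vector Carrier (sucℕ d)) →
      ∃[ x ] (x ^ sucℕ d + (∑[ k < sucℕ d ] (a k * x ^ toℕ k))) ≈ 0#

    i    : Carrier
    i²   : i * i ≈ - 1#
    √3   : Carrier
    √3²  : √3 * √3 ≈ 3 · 1#

  ½ : Carrier
  ½ = proj₁ (#⇒invertible (characteristic-0 1))

  fromℤ : ℤ → Carrier
  fromℤ (+ n)    = n · 1#
  fromℤ -[1+ n ] = - (sucℕ n · 1#)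

  -- In ℂ, exp(2πi/3) = (-1 + i√3)/2.
  ω₃ : Carrier
  ω₃ = (- 1# + i * √3) * ½

  IsInteger : Pred Carrier ℓ₁
  IsInteger x = ∃[ a ] x ≈ fromℤ a

  IsEisensteinInteger : Pred Carrier ℓ₁
  IsEisensteinInteger x = ∃[ a ] ∃[ b ] x ≈ fromℤ a + fromℤ b * ω₃

  Matrix : ℕ → Set c
  Matrix n = Vector (Vector Carrier n) n

  IsEigenvalue : ∀ {n} → Matrix n → Pred Carrier (c ⊔ ℓ₁ ⊔ ℓ₂)
  IsEigenvalue {n} M μ = Σ[ v ∈ Vector Carrier n ]
    (∃[ k ] v k # 0#) ×
    (∀ u → (∑[ w < n ] (M u w * v w)) ≈ μ * v u)

-- An undirected edge {u,v} is represented by the two arcs (u,v), (v,u).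
record MixedGraph a ℓ e : Set (suc (a ⊔ ℓ ⊔ e)) where
  field
    vertices    : Setoid a ℓ
    order       : ℕ
    enumeration : Inverse vertices (≡-setoid (Fin order))

  open Setoid vertices renaming (Carrier to Vertex)

  field
    Edge      : Rel Vertex e
    edge?     : Decidable₂ Edge
    edge-resp : Edge Respects₂ _≈_
    loopless  : ∀ v → ¬ Edge v v

  vertex : Fin order → Vertex
  vertex = Inverse.from enumeration

  hasEdge : Fin order → Fin order → Bool
  hasEdge u v = does (edge? (vertex u) (vertex v))

module _ {c ℓ₁ ℓ₂ a ℓ e : Level}
         (K : ComplexField c ℓ₁ ℓ₂) (G : MixedGraph a ℓ e) where

  open ComplexField K
  open MixedGraph G

  𝒜 : Matrix order
  𝒜 u v = if hasEdge u v then 1# else 0#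

  ℋ : Matrix order
  ℋ u v = entry (hasEdge u v) (hasEdge v u)
    where
    entry : Bool → Bool → Carrier
    entry true  true  = 1#
    entry true  false = (1# + i * √3) * ½
    entry false true  = (1# - i * √3) * ½
    entry false false = 0#

  HSIntegral : Set (c ⊔ ℓ₁ ⊔ ℓ₂)
  HSIntegral = ∀ μ → IsEigenvalue ℋ μ → IsInteger μ

  EisensteinIntegral : Set (c ⊔ ℓ₁ ⊔ ℓ₂)
  EisensteinIntegral = ∀ μ → IsEigenvalue 𝒜 μ → IsEisensteinInteger μ

record FiniteGroup a ℓ : Set (suc (a ⊔ ℓ)) where
  field
    group       : Group a ℓ
    order       : ℕ
    enumeration : Inverse (Group.setoid group) (≡-setoid (Fin order))

  open Group group public

module _ {a ℓ : Level} (Γ : FiniteGroup a ℓ) where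

  open FiniteGroup Γ

  -- Membership is decidable so that the 0-1 entries can be defined by
  -- cases.
  record ConnectionSet p : Set (a ⊔ ℓ ⊔ suc p) where
    field
      Member  : Pred Carrier p
      member? : Decidable Member
      resp    : Member Respects _≈_
      ε∉      : ¬ Member ε

  IsConjugate : Rel Carrier (a ⊔ ℓ)
  IsConjugate x y = ∃[ g ] y ≈ (g ∙ x) ∙ g ⁻¹

  -- T is a set of representatives of the classes making up the union
  -- (repetitions allowed).
  IsUnionOfConjugacyClasses : ∀ {p} → Pred Carrier p → Set (a ⊔ ℓ ⊔ suc p)
  IsUnionOfConjugacyClasses {p} P = Σ[ T ∈ Pred Carrier p ]
    (∀ x → P x ⇔ (∃[ t ] T t × IsConjugate t x))

  IsNormal : ∀ {p} → ConnectionSet p → Set (a ⊔ ℓ ⊔ suc p)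
  IsNormal S = IsUnionOfConjugacyClasses (ConnectionSet.Member S)

  Cay : ∀ {p} → ConnectionSet p → MixedGraph a ℓ p
  Cay S = record
    { vertices    = setoid
    ; order       = order
    ; enumeration = enumeration
    ; Edge        = λ x y → Member (y ∙ x ⁻¹)
    ; edge?       = λ x y → member? (y ∙ x ⁻¹)
    ; edge-resp   = (λ y≈z → resp (∙-congʳ y≈z))
                  , (λ y≈z → resp (∙-congˡ (⁻¹-cong y≈z)))
    ; loopless    = λ x x∈ → ε∉ (resp (inverseʳ x) x∈)
    }
    where open ConnectionSet S

{-# OPTIONS --safe #-}

-- Let A be the (0,1)-adjacency matrix, ω₆ = (1 + i√3)/2 = 1 + ω and ω̄₆ its
-- conjugate.  Then H = ω₆ A + ω̄₆ Aᵀ.  As S is a union of conjugacy classes,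
-- A commutes with Aᵀ, and the permutation u ↦ u⁻¹ of the vertices turns A
-- into Aᵀ.  Hence an eigenvector of A or of H yields a common eigenvector of
-- A and Aᵀ, with eigenvalues λ₁ and λ₂, and one with λ₂ and λ₁; so λ₁ and λ₂ are
-- eigenvalues of A, while μ₁ = ω₆ λ₁ + ω̄₆ λ₂ and μ₂ = ω₆ λ₂ + ω̄₆ λ₁ are
-- eigenvalues of H.
--
-- If λ₁ and λ₂ are Eisenstein integers then so is μ₁, and it is fixed by
-- conjugation because H is Hermitian.  Conversely, if μ₁ and μ₂ are integers then
-- √-3 λ₁ = ω₆ μ₁ - ω̄₆ μ₂ is an Eisenstein integer, and λ₁ itself is one because
-- the entries of A are integers.
--
-- The field is abstract: it carries no conjugation, and equality in it is not
-- decidable.  Arguments with norms and divisibility are therefore made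
-- on eigenvectors over ℤ[ω], which an eigenvector over K always gives when
-- the eigenvalue is in ℚ(ω).  Existence of eigenvectors is only
-- obtained doubly negated; the conclusion is reached since an eigenvalue
-- known to be an Eisenstein integer is confined to an explicit finite set.

module Submission where

open import Defs
open import Algebra.Bundles using (CommutativeRing)
import Algebra.Properties.AbelianGroup as AbelianGroupProperties
import Algebra.Properties.Group as GroupProperties
import Algebra.Properties.Ring as RingProperties
import Algebra.Properties.Semiring.Mult as Mult
import Algebra.Properties.Semiring.Sum as Sum
import Algebra.Solver.Ring
import Algebra.Solver.Ring.Simple
open import Algebra.Solver.Ring.AlmostCommutativeRing
  using (fromCommutativeRing; _-Raw-AlmostCommutative⟶_)
open import Data.Bool.Base using (Bool; true; false; if_then_else_)
open import Data.Fin.Base using (Fin; zero; suc; punchIn; punchOut; toℕ)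
open import Data.Fin.Permutation as Permutation using (Permutation; permutation; _⟨$⟩ʳ_; _⟨$⟩ˡ_)
import Data.Fin.Properties as Fin
open import Data.Integer.Base as ℤ using (ℤ; +_; -[1+_])
open import Data.Integer.DivMod using (_%ℕ_; _/ℕ_; a≡a%ℕn+[a/ℕn]*n; n%ℕd<d)
import Data.Integer.Properties as ℤₚ
open import Data.Integer.Tactic.RingSolver using (solve-∀)
open import Data.List.Base using (List; []; _∷_; _++_; map; upTo; cartesianProductWith)
open import Data.List.Membership.Propositional using (_∈_)
open import Data.List.Membership.Propositional.Properties
  using (∈-map⁺; ∈-++⁺ˡ; ∈-++⁺ʳ; ∈-upTo⁺; ∈-cartesianProductWith⁺)
open import Data.List.Relation.Unary.Any using (here; there)
import Data.Maybe.Base as Maybe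
open import Data.Nat.Base as ℕ using (ℕ; zero; suc)
open import Data.Nat.Induction using (<-rec)
import Data.Nat.Properties as ℕ
open import Data.Product.Base using (_×_; _,_; proj₁; proj₂; ∃-syntax; Σ-syntax)
open import Data.Sum.Base using (_⊎_; inj₁; inj₂; [_,_]′)
open import Data.Vec.Functional as Vector using (Vector; tail)
open import Function.Base using (_∘_; id; _⟨_⟩_)
open import Function.Bundles using (Inverse; Equivalence; _⇔_; mk⇔)
open import Level using (0ℓ; _⊔_)
open import Relation.Binary.Definitions using (DecidableEquality)
open import Relation.Binary.PropositionalEquality as ≡ using (_≡_; _≢_)
import Relation.Binary.Reasoning.Setoid as ≈-Reasoning
open import Relation.Nullary using (¬_; Dec; yes; no)
open import Relation.Nullary.Decidable
  using (does; does-⇔; decidable-stable; dec⇒maybe; map′; _×-dec_; ¬¬-excluded-middle)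
open import Relation.Nullary.Negation using (contradiction; ¬¬-map)
open import Relation.Unary using (Pred)

-- Finite sums over a commutative ring.

module SumProperties {c ℓ} (R : CommutativeRing c ℓ) where
  open CommutativeRing R
  open Sum semiring

  sum-zero : ∀ {n} (f : Vector Carrier n) → (∀ i → f i ≈ 0#) → sum f ≈ 0#
  sum-zero {n} f f≈0 = trans (sum-cong-≋ f≈0) (sum-replicate-zero n)

  sum-+-* : ∀ {n} (f g : Vector Carrier n) q →
            ∑[ i < n ] (f i + g i * q) ≈ sum f + sum g * q
  sum-+-* f g q = trans (∑-distrib-+ f (λ i → g i * q)) (+-congˡ (sym (*-distribʳ-sum q g)))

  δ : ∀ {n} → Fin n → Fin n → Carrier
  δ zero    zero    = 1#
  δ zero    (suc _) = 0#
  δ (suc _) zero    = 0#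
  δ (suc u) (suc w) = δ u w

  sum-δ : ∀ {n} (u : Fin n) (f : Vector Carrier n) → ∑[ w < n ] (δ u w * f w) ≈ f u
  sum-δ zero f =
    trans (+-cong (*-identityˡ _) (sum-zero (λ w → 0# * f (suc w)) (λ w → zeroˡ _))) (+-identityʳ _)
  sum-δ (suc u) f = trans (+-cong (zeroˡ _) (sum-δ u (f ∘ suc))) (+-identityˡ _)

  sum-linear : ∀ {n} d e (r s f : Vector Carrier n) →
               ∑[ k < n ] ((d * r k - e * s k) * f k) ≈
               d * (∑[ k < n ] (r k * f k)) - e * (∑[ k < n ] (s k * f k))
  sum-linear {n} d e r s f = begin
    ∑[ k < n ] ((d * r k - e * s k) * f k)
      ≈⟨ sum-cong-≋ rearrange ⟩
    ∑[ k < n ] (d * (r k * f k) + s k * f k * - e)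
      ≈⟨ sum-+-* (λ k → d * (r k * f k)) (λ k → s k * f k) (- e) ⟩
    (∑[ k < n ] (d * (r k * f k))) + (∑[ k < n ] (s k * f k)) * - e
      ≈⟨ +-cong (sym (*-distribˡ-sum d (λ k → r k * f k))) (trans (*-comm _ _) (sym (-‿distribˡ-* _ _))) ⟩
    d * (∑[ k < n ] (r k * f k)) - e * (∑[ k < n ] (s k * f k)) ∎
    where
    open ≈-Reasoning setoid
    open RingProperties ring using (-‿distribˡ-*)
    rearrange : ∀ k → (d * r k - e * s k) * f k ≈ d * (r k * f k) + s k * f k * - e
    rearrange k = trans (distribʳ _ _ _) (+-cong (*-assoc _ _ _)
      (trans (*-congʳ (-‿distribˡ-* _ _)) (trans (*-assoc _ _ _) (*-comm _ _))))

  -- Row `u` of the matrix d M - e I: this turns a scaled eigenvector equation into a single linear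
  -- relation among the coordinates.
  sum-sub-δ : ∀ {n} d e (r f : Vector Carrier n) u →
              ∑[ w < n ] ((d * r w - e * δ u w) * f w) ≈ d * (∑[ w < n ] (r w * f w)) - e * f u
  sum-sub-δ d e r f u = trans (sum-linear d e r (δ u) f) (+-congˡ (-‿cong (*-congˡ (sum-δ u f))))

-- Eisenstein integers

module EisensteinIntegers where
  open import Data.Integer.Base using (_+_; _*_; -_; _-_; _≤_; _<_; +≤+; ∣_∣; nonNegative; positive)

  infix 5 _+ω_

  -- A datatype rather than ℤ × ℤ, so that the operations below do not unfold
  -- on neutral terms.
  data ℤ[ω] : Set where
    _+ω_ : ℤ → ℤ → ℤ[ω]

  infixl 6 _⊕_
  infixl 7 _⊛_

  _⊕_ _⊛_ : ℤ[ω] → ℤ[ω] → ℤ[ω]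
  (a +ω b) ⊕ (c +ω d) = a + c +ω b + d
  (a +ω b) ⊛ (c +ω d) = a * c - b * d +ω a * d + b * c - b * d

  ⊖_ : ℤ[ω] → ℤ[ω]
  ⊖ (a +ω b) = - a +ω - b

  𝔼-commutativeRing : CommutativeRing 0ℓ 0ℓ
  𝔼-commutativeRing = record
    { Carrier = ℤ[ω] ; _≈_ = _≡_ ; _+_ = _⊕_ ; _*_ = _⊛_ ; -_ = ⊖_
    ; 0# = + 0 +ω + 0 ; 1# = + 1 +ω + 0
    ; isCommutativeRing = record
      { isRing = record
        { +-isAbelianGroup = record
          { isGroup = record
            { isMonoid = record
              { isSemigroup = record
                { isMagma = record
                  { isEquivalence = ≡.isEquivalence ; ∙-cong = ≡.cong₂ _⊕_ }
                ; assoc = λ { (a +ω b) (c +ω d) (e +ω f) → ≡.cong₂ _+ω_ (ℤₚ.+-assoc a c e) (ℤₚ.+-assoc b d f) }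
                }
              ; identity = (λ { (a +ω b) → ≡.cong₂ _+ω_ (ℤₚ.+-identityˡ a) (ℤₚ.+-identityˡ b) })
                         , (λ { (a +ω b) → ≡.cong₂ _+ω_ (ℤₚ.+-identityʳ a) (ℤₚ.+-identityʳ b) })
              }
            ; inverse = (λ { (a +ω b) → ≡.cong₂ _+ω_ (ℤₚ.+-inverseˡ a) (ℤₚ.+-inverseˡ b) })
                      , (λ { (a +ω b) → ≡.cong₂ _+ω_ (ℤₚ.+-inverseʳ a) (ℤₚ.+-inverseʳ b) })
            ; ⁻¹-cong = ≡.cong ⊖_
            }
          ; comm = λ { (a +ω b) (c +ω d) → ≡.cong₂ _+ω_ (ℤₚ.+-comm a c) (ℤₚ.+-comm b d) }
          }
        ; *-cong = ≡.cong₂ _⊛_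
        ; *-assoc = λ { (a +ω b) (c +ω d) (e +ω f) → ≡.cong₂ _+ω_ (assoc₁ a b c d e f) (assoc₂ a b c d e f) }
        ; *-identity = (λ { (a +ω b) → ≡.cong₂ _+ω_ (idˡ₁ a b) (idˡ₂ a b) })
                     , (λ { (a +ω b) → ≡.cong₂ _+ω_ (idʳ₁ a b) (idʳ₂ a b) })
        ; distrib = (λ { (a +ω b) (c +ω d) (e +ω f) → ≡.cong₂ _+ω_ (distˡ₁ a b c d e f) (distˡ₂ a b c d e f) })
                  , (λ { (a +ω b) (c +ω d) (e +ω f) → ≡.cong₂ _+ω_ (distʳ₁ a b c d e f) (distʳ₂ a b c d e f) })
        }
      ; *-comm = λ { (a +ω b) (c +ω d) → ≡.cong₂ _+ω_ (comm₁ a b c d) (comm₂ a b c d) }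
      }
    }
    where
    assoc₁ : ∀ a b c d e f →
      (a * c - b * d) * e - (a * d + b * c - b * d) * f ≡
      a * (c * e - d * f) - b * (c * f + d * e - d * f)
    assoc₁ = solve-∀
    assoc₂ : ∀ a b c d e f →
      (a * c - b * d) * f + (a * d + b * c - b * d) * e - (a * d + b * c - b * d) * f ≡
      a * (c * f + d * e - d * f) + b * (c * e - d * f) - b * (c * f + d * e - d * f)
    assoc₂ = solve-∀
    idˡ₁ : ∀ a b → + 1 * a - + 0 * b ≡ a
    idˡ₁ = solve-∀
    idˡ₂ : ∀ a b → + 1 * b + + 0 * a - + 0 * b ≡ b
    idˡ₂ = solve-∀
    idʳ₁ : ∀ a b → a * + 1 - b * + 0 ≡ a
    idʳ₁ = solve-∀
    idʳ₂ : ∀ a b → a * + 0 + b * + 1 - b * + 0 ≡ b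
    idʳ₂ = solve-∀
    distˡ₁ : ∀ a b c d e f → a * (c + e) - b * (d + f) ≡ (a * c - b * d) + (a * e - b * f)
    distˡ₁ = solve-∀
    distˡ₂ : ∀ a b c d e f → a * (d + f) + b * (c + e) - b * (d + f) ≡
      (a * d + b * c - b * d) + (a * f + b * e - b * f)
    distˡ₂ = solve-∀
    distʳ₁ : ∀ a b c d e f → (c + e) * a - (d + f) * b ≡ (c * a - d * b) + (e * a - f * b)
    distʳ₁ = solve-∀
    distʳ₂ : ∀ a b c d e f → (c + e) * b + (d + f) * a - (d + f) * b ≡
      (c * b + d * a - d * b) + (e * b + f * a - f * b)
    distʳ₂ = solve-∀
    comm₁ : ∀ a b c d → a * c - b * d ≡ c * a - d * b
    comm₁ = solve-∀
    comm₂ : ∀ a b c d → a * d + b * c - b * d ≡ c * b + d * a - d * b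
    comm₂ = solve-∀

  module 𝔼 = CommutativeRing 𝔼-commutativeRing

  _≟_ : DecidableEquality ℤ[ω]
  (a +ω b) ≟ (c +ω d) = map′ (λ { (≡.refl , ≡.refl) → ≡.refl }) (λ { ≡.refl → ≡.refl , ≡.refl })
                             (a ℤₚ.≟ c ×-dec b ℤₚ.≟ d)

  module 𝔼-Solver = Algebra.Solver.Ring.Simple (fromCommutativeRing 𝔼-commutativeRing) _≟_

  -- Conjugation and the norm.

  conj : ℤ[ω] → ℤ[ω]
  conj (a +ω b) = a - b +ω - b

  norm : ℤ[ω] → ℤ
  norm (a +ω b) = a * a - a * b + b * b


  conj-+ : ∀ x y → conj (x 𝔼.+ y) ≡ conj x 𝔼.+ conj y
  conj-+ (a +ω b) (c +ω d) = ≡.cong₂ _+ω_ (eq a b c d) (ℤₚ.neg-distrib-+ b d)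
    where
    eq : ∀ a b c d → a + c - (b + d) ≡ a - b + (c - d)
    eq = solve-∀

  conj-* : ∀ x y → conj (x 𝔼.* y) ≡ conj x 𝔼.* conj y
  conj-* (a +ω b) (c +ω d) = ≡.cong₂ _+ω_ (eq₁ a b c d) (eq₂ a b c d)
    where
    eq₁ : ∀ a b c d → (a * c - b * d) - (a * d + b * c - b * d) ≡ (a - b) * (c - d) - (- b) * (- d)
    eq₁ = solve-∀
    eq₂ : ∀ a b c d → - (a * d + b * c - b * d) ≡ (a - b) * (- d) + (- b) * (c - d) - (- b) * (- d)
    eq₂ = solve-∀

  *-conj : ∀ x → x 𝔼.* conj x ≡ norm x +ω + 0
  *-conj (a +ω b) = ≡.cong₂ _+ω_ (eq₁ a b) (eq₂ a b)
    where
    eq₁ : ∀ a b → a * (a - b) - b * - b ≡ a * a - a * b + b * b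
    eq₁ = solve-∀
    eq₂ : ∀ a b → a * - b + b * (a - b) - b * - b ≡ + 0
    eq₂ = solve-∀

  norm-* : ∀ x y → norm (x 𝔼.* y) ≡ norm x * norm y
  norm-* (a +ω b) (c +ω d) = eq a b c d
    where
    eq : ∀ a b c d → let p = a * c - b * d ; q = a * d + b * c - b * d in
      p * p - p * q + q * q ≡ (a * a - a * b + b * b) * (c * c - c * d + d * d)
    eq = solve-∀

  0≤i*i : ∀ i → + 0 ≤ i * i
  0≤i*i (+ n) rewrite ≡.sym (ℤₚ.pos-* n n) = +≤+ ℕ.z≤n
  0≤i*i -[1+ n ] = +≤+ ℕ.z≤n

  -- Four times the norm is a² + 2a² + (a - 2b)². Positivity and definiteness of the norm, and
  -- bounds on single coordinates, all follow from this.
  i*i≤4norm : ∀ a b → a * a ≤ + 4 * norm (a +ω b)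
  i*i≤4norm a b = begin
    a * a                                          ≤⟨ ℤₚ.i≤i+j (a * a) _ {{nonNegative rest}} ⟩
    a * a + (+ 2 * (a * a) + (a - + 2 * b) * (a - + 2 * b))  ≡⟨ eq a b ⟩
    + 4 * norm (a +ω b)                             ∎
    where
    open ℤₚ.≤-Reasoning
    eq : ∀ a b → a * a + (+ 2 * (a * a) + (a - + 2 * b) * (a - + 2 * b)) ≡ + 4 * (a * a - a * b + b * b)
    eq = solve-∀
    rest : + 0 ≤ + 2 * (a * a) + (a - + 2 * b) * (a - + 2 * b)
    rest = ℤₚ.+-mono-≤ (ℤₚ.*-monoˡ-≤-nonNeg (+ 2) (0≤i*i a)) (0≤i*i (a - + 2 * b))

  norm-swap : ∀ a b → norm (a +ω b) ≡ norm (b +ω a)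
  norm-swap = eq
    where
    eq : ∀ a b → a * a - a * b + b * b ≡ b * b - b * a + a * a
    eq = solve-∀

  0≤norm : ∀ x → + 0 ≤ norm x
  0≤norm (a +ω b) = ℤₚ.*-cancelˡ-≤-pos _ _ (+ 4) (ℤₚ.≤-trans (0≤i*i a) (i*i≤4norm a b))

  norm≡0⇒≡0 : ∀ x → norm x ≡ + 0 → x ≡ 𝔼.0#
  norm≡0⇒≡0 (a +ω b) eq = ≡.cong₂ _+ω_ (vanish a b eq) (vanish b a (≡.trans (norm-swap b a) eq))
    where
    vanish : ∀ a b → norm (a +ω b) ≡ + 0 → a ≡ + 0
    vanish a b eq = [ id , id ]′ (ℤₚ.i*j≡0⇒i≡0∨j≡0 a a*a≡0)
      where
      a*a≡0 : a * a ≡ + 0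
      a*a≡0 = ℤₚ.≤-antisym (ℤₚ.≤-trans (i*i≤4norm a b) (ℤₚ.≤-reflexive (≡.cong (+ 4 *_) eq))) (0≤i*i a)

  ∣a∣≤4norm : ∀ a b → ∣ a ∣ ℕ.≤ 4 ℕ.* ∣ norm (a +ω b) ∣
  ∣a∣≤4norm a b = ℕ.≤-trans (m≤m*m ∣ a ∣) (ℕ.≤-trans (ℕ.≤-reflexive (≡.sym (ℤₚ.abs-* a a)))
    (ℕ.≤-trans (abs-mono (0≤i*i a) (i*i≤4norm a b)) (ℕ.≤-reflexive (ℤₚ.abs-* (+ 4) (norm (a +ω b))))))
    where
    m≤m*m : ∀ m → m ℕ.≤ m ℕ.* m
    m≤m*m zero    = ℕ.z≤n
    m≤m*m (suc m) = ℕ.m≤m+n (suc m) _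
    abs-mono : ∀ {i j} → + 0 ≤ i → i ≤ j → ∣ i ∣ ℕ.≤ ∣ j ∣
    abs-mono (+≤+ _) (+≤+ i≤j) = i≤j

  -- The norm is multiplicative and definite, and ℤ has no zero divisors.
  x*y≡0⇒y≡0 : ∀ x y → x ≢ 𝔼.0# → x 𝔼.* y ≡ 𝔼.0# → y ≡ 𝔼.0#
  x*y≡0⇒y≡0 x y x≢0 xy≡0 =
    [ (λ nx≡0 → contradiction (norm≡0⇒≡0 x nx≡0) x≢0) , norm≡0⇒≡0 y ]′
      (ℤₚ.i*j≡0⇒i≡0∨j≡0 (norm x) {norm y} (≡.trans (≡.sym (norm-* x y)) (≡.cong norm xy≡0)))

  -- The norm is the square of the absolute value, so the triangle inequality is replaced by the
  -- parallelogram law with the term `norm (x 𝔼.- y)` dropped.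
  norm-+ : ∀ x y → norm (x 𝔼.+ y) ≤ + 2 * (norm x + norm y)
  norm-+ x@(a +ω b) y@(c +ω d) = begin
    norm (x 𝔼.+ y)  ≤⟨ ℤₚ.i≤i+j _ _ {{nonNegative (0≤norm (x 𝔼.- y))}} ⟩
    norm (x 𝔼.+ y) + norm (x 𝔼.- y)  ≡⟨ parallelogram a b c d ⟩
    + 2 * (norm x + norm y)  ∎
    where
    open ℤₚ.≤-Reasoning
    parallelogram : ∀ a b c d → ((a + c) * (a + c) - (a + c) * (b + d) + (b + d) * (b + d)) +
      ((a + - c) * (a + - c) - (a + - c) * (b + - d) + (b + - d) * (b + - d)) ≡
      + 2 * ((a * a - a * b + b * b) + (c * c - c * d + d * d))
    parallelogram = solve-∀

  module ∑𝔼 where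
    open Sum 𝔼.semiring public
    open SumProperties 𝔼-commutativeRing public

  open ∑𝔼 using (sum; sum-syntax)

  -- Eigenvalues of matrices over ℤ[ω].

  -- Equal to 2ⁿ⁺¹ - 2: each further summand costs one use of `norm-+`. The bound is crude, but any
  -- explicit bound makes the set of candidates finite.
  norm-bound : ℕ → ℤ
  norm-bound zero    = + 0
  norm-bound (suc n) = + 2 * (+ 1 + norm-bound n)

  norm-sum : ∀ {n} (f : Vector ℤ[ω] n) B → (∀ i → norm (f i) ≤ B) → norm (sum f) ≤ norm-bound n * B
  norm-sum {zero}  f B f≤B = +≤+ ℕ.z≤n
  norm-sum {suc n} f B f≤B = begin
    norm (sum f)                                  ≤⟨ norm-+ (f zero) (sum (f ∘ suc)) ⟩
    + 2 * (norm (f zero) + norm (sum (f ∘ suc)))  ≤⟨ ℤₚ.*-monoˡ-≤-nonNeg (+ 2) (ℤₚ.+-mono-≤ (f≤B zero) (norm-sum (f ∘ suc) B (f≤B ∘ suc))) ⟩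
    + 2 * (B + norm-bound n * B)                  ≡⟨ eq B (norm-bound n) ⟩
    norm-bound (suc n) * B                        ∎
    where
    open ℤₚ.≤-Reasoning
    eq : ∀ b c → + 2 * (b + c * b) ≡ + 2 * (+ 1 + c) * b
    eq = solve-∀

  argmax : ∀ {n} (f : Vector ℤ (suc n)) → ∃[ u ] (∀ w → f w ≤ f u)
  argmax {zero}  f = zero , λ { zero → ℤₚ.≤-refl }
  argmax {suc n} f with argmax (f ∘ suc)
  ... | u , max with ℤₚ.≤-total (f zero) (f (suc u))
  ...   | inj₁ f₀≤ = suc u , λ { zero → f₀≤ ; (suc w) → max w }
  ...   | inj₂ ≤f₀ = zero , λ { zero → ℤₚ.≤-refl ; (suc w) → ℤₚ.≤-trans (max w) ≤f₀ }

  -- Compare both sides of the eigenvector equation at a coordinate where `z` has maximal norm, then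
  -- cancel that norm.
  norm-eigenvalue : ∀ {n} (M : Fin n → Fin n → ℤ[ω]) → (∀ u w → norm (M u w) ≤ + 1) →
    ∀ μ (z : Vector ℤ[ω] n) → ∃[ u ] z u ≢ 𝔼.0# →
    (∀ u → ∑[ w < n ] (M u w 𝔼.* z w) ≡ μ 𝔼.* z u) → norm μ ≤ norm-bound n
  norm-eigenvalue {suc n} M M≤1 μ z (k , zₖ≢0) Mz≡μz with argmax (norm ∘ z)
  ... | u , max = ℤₚ.*-cancelʳ-≤-pos _ _ (norm (z u)) {{positive 0<norm}} (begin
    norm μ * norm (z u)                        ≡⟨ norm-* μ (z u) ⟨
    norm (μ 𝔼.* z u)                           ≡⟨ ≡.cong norm (Mz≡μz u) ⟨
    norm (∑[ w < suc n ] (M u w 𝔼.* z w))      ≤⟨ norm-sum (λ w → M u w 𝔼.* z w) (norm (z u)) bound ⟩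
    norm-bound (suc n) * norm (z u)            ∎)
    where
    open ℤₚ.≤-Reasoning
    0<norm : + 0 < norm (z u)
    0<norm = ℤₚ.<-≤-trans (ℤₚ.≤∧≢⇒< (0≤norm (z k)) (zₖ≢0 ∘ norm≡0⇒≡0 (z k) ∘ ≡.sym)) (max k)
    bound : ∀ w → norm (M u w 𝔼.* z w) ≤ norm (z u)
    bound w = begin
      norm (M u w 𝔼.* z w)       ≡⟨ norm-* (M u w) (z w) ⟩
      norm (M u w) * norm (z w)  ≤⟨ ℤₚ.*-monoʳ-≤-nonNeg (norm (z w)) {{nonNegative (0≤norm (z w))}} (M≤1 u w) ⟩
      + 1 * norm (z w)           ≡⟨ ℤₚ.*-identityˡ _ ⟩
      norm (z w)                 ≤⟨ max w ⟩
      norm (z u)                 ∎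

  conj-sum : ∀ {n} (f : Vector ℤ[ω] n) → conj (sum f) ≡ sum (conj ∘ f)
  conj-sum {zero}  f = ≡.refl
  conj-sum {suc n} f = ≡.trans (conj-+ (f zero) _) (≡.cong (conj (f zero) 𝔼.+_) (conj-sum (f ∘ suc)))

  re : ℤ[ω] → ℤ
  re (a +ω b) = a

  -- The squared length of `z` is a rational integer that dominates the norm of each coordinate,
  -- hence it cannot vanish unless `z` does.
  sum-norm : ∀ {n} (z : Vector ℤ[ω] n) →
    ∃[ s ] ∑[ u < n ] (z u 𝔼.* conj (z u)) ≡ (s +ω + 0) × + 0 ≤ s × (∀ u → norm (z u) ≤ s)
  sum-norm {zero}  z = + 0 , ≡.refl , ℤₚ.≤-refl , λ ()
  sum-norm {suc n} z = let s , eq , 0≤s , ≤s = sum-norm (z ∘ suc) in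
    norm (z zero) + s , ≡.cong₂ 𝔼._+_ (*-conj (z zero)) eq , ℤₚ.+-mono-≤ (0≤norm (z zero)) 0≤s ,
    λ { zero    → ℤₚ.i≤i+j _ s {{nonNegative 0≤s}}
      ; (suc u) → ℤₚ.≤-trans (≤s u) (ℤₚ.i≤j+i s _ {{nonNegative (0≤norm (z zero))}}) }

  sum-norm≢0 : ∀ {n} (z : Vector ℤ[ω] n) → ∃[ u ] z u ≢ 𝔼.0# → ∑[ u < n ] (z u 𝔼.* conj (z u)) ≢ 𝔼.0#
  sum-norm≢0 z (u , zᵤ≢0) ≡0 = let s , eq , _ , ≤s = sum-norm z in
    zᵤ≢0 (norm≡0⇒≡0 (z u) (ℤₚ.≤-antisym
      (ℤₚ.≤-trans (≤s u) (ℤₚ.≤-reflexive (≡.cong re (≡.trans (≡.sym eq) ≡0)))) (0≤norm (z u))))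

  *-cancelˡ : ∀ d {x y} → d ≢ 𝔼.0# → d 𝔼.* x ≡ d 𝔼.* y → x ≡ y
  *-cancelˡ d {x} {y} d≢0 dx≡dy = x-y≡0⇒x≡y (x*y≡0⇒y≡0 d (x 𝔼.- y) d≢0
    (≡.trans (𝔼-Solver.solve 3 (λ d x y → d :* (x :- y) := d :* x :- d :* y) ≡.refl d x y)
             (≡.trans (≡.cong (𝔼._- d 𝔼.* y) dx≡dy) (𝔼.-‿inverseʳ (d 𝔼.* y)))))
    where
    open 𝔼-Solver
    open RingProperties 𝔼.ring using () renaming (x∙y⁻¹≈ε⇒x≈y to x-y≡0)
    x-y≡0⇒x≡y : x 𝔼.- y ≡ 𝔼.0# → x ≡ y
    x-y≡0⇒x≡y = x-y≡0 x y

  -- Evaluating the Hermitian form of `M` at `z` in two ways gives ∥z∥² times `conj μ` and ∥z∥²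
  -- times `μ`; the nonzero factor cancels.
  hermitian-eigenvalue : ∀ {n} (M : Fin n → Fin n → ℤ[ω]) → (∀ u w → M u w ≡ conj (M w u)) →
    ∀ μ (z : Vector ℤ[ω] n) → ∃[ u ] z u ≢ 𝔼.0# →
    (∀ u → ∑[ w < n ] (M u w 𝔼.* z w) ≡ μ 𝔼.* z u) → conj μ ≡ μ
  hermitian-eigenvalue {n} M M≡M* μ z z≢0 Mz≡μz = *-cancelˡ ∥z∥² (sum-norm≢0 z z≢0) (begin
    ∥z∥² 𝔼.* conj μ             ≡⟨ 𝔼.*-comm ∥z∥² (conj μ) ⟩
    conj μ 𝔼.* ∥z∥²             ≡⟨ ∑𝔼.*-distribˡ-sum (conj μ) (λ u → z u 𝔼.* conj (z u)) ⟩
    ∑[ u < n ] (conj μ 𝔼.* (z u 𝔼.* conj (z u)))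
      ≡⟨ ∑𝔼.sum-cong-≗ (λ u → ≡.trans (swap (conj μ) (z u) (conj (z u)))
           (≡.cong (z u 𝔼.*_) (≡.trans (≡.sym (conj-* μ (z u))) (≡.cong conj (≡.sym (Mz≡μz u)))))) ⟩
    ∑[ u < n ] (z u 𝔼.* conj (∑[ w < n ] (M u w 𝔼.* z w)))
      ≡⟨ ∑𝔼.sum-cong-≗ (λ u → ≡.trans (≡.cong (z u 𝔼.*_) (conj-sum (λ w → M u w 𝔼.* z w))) (∑𝔼.*-distribˡ-sum (z u) (λ w → conj (M u w 𝔼.* z w)))) ⟩
    ∑[ u < n ] ∑[ w < n ] (z u 𝔼.* conj (M u w 𝔼.* z w))
      ≡⟨ ∑𝔼.∑-comm (λ u w → z u 𝔼.* conj (M u w 𝔼.* z w)) ⟩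
    ∑[ w < n ] ∑[ u < n ] (z u 𝔼.* conj (M u w 𝔼.* z w))
      ≡⟨ ∑𝔼.sum-cong-≗ (λ w → ∑𝔼.sum-cong-≗ (λ u → adjoint u w)) ⟩
    ∑[ w < n ] ∑[ u < n ] (conj (z w) 𝔼.* (M w u 𝔼.* z u))
      ≡⟨ ∑𝔼.sum-cong-≗ (λ w → ≡.trans (≡.sym (∑𝔼.*-distribˡ-sum (conj (z w)) (λ u → M w u 𝔼.* z u))) (≡.cong (conj (z w) 𝔼.*_) (Mz≡μz w))) ⟩
    ∑[ w < n ] (conj (z w) 𝔼.* (μ 𝔼.* z w))
      ≡⟨ ∑𝔼.sum-cong-≗ (λ w → ≡.trans (swap (conj (z w)) μ (z w)) (≡.cong (μ 𝔼.*_) (𝔼.*-comm (conj (z w)) (z w)))) ⟩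
    ∑[ w < n ] (μ 𝔼.* (z w 𝔼.* conj (z w)))  ≡⟨ ∑𝔼.*-distribˡ-sum μ (λ w → z w 𝔼.* conj (z w)) ⟨
    μ 𝔼.* ∥z∥²                  ≡⟨ 𝔼.*-comm μ ∥z∥² ⟩
    ∥z∥² 𝔼.* μ                  ∎)
    where
    open ≡.≡-Reasoning
    ∥z∥² : ℤ[ω]
    ∥z∥² = ∑[ u < n ] (z u 𝔼.* conj (z u))
    swap : ∀ x y z → x 𝔼.* (y 𝔼.* z) ≡ y 𝔼.* (x 𝔼.* z)
    swap = 𝔼-Solver.solve 3 (λ x y z → x :* (y :* z) := y :* (x :* z)) ≡.refl
      where open 𝔼-Solver
    adjoint : ∀ u w → z u 𝔼.* conj (M u w 𝔼.* z w) ≡ conj (z w) 𝔼.* (M w u 𝔼.* z u)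
    adjoint u w = begin
      z u 𝔼.* conj (M u w 𝔼.* z w)          ≡⟨ ≡.cong (z u 𝔼.*_) (conj-* (M u w) (z w)) ⟩
      z u 𝔼.* (conj (M u w) 𝔼.* conj (z w)) ≡⟨ ≡.cong (λ h → z u 𝔼.* (h 𝔼.* conj (z w))) (M≡M* w u) ⟨
      z u 𝔼.* (M w u 𝔼.* conj (z w))        ≡⟨ 𝔼-Solver.solve 3 (λ x y z → x :* (y :* z) := z :* (y :* x)) ≡.refl (z u) (M w u) (conj (z w)) ⟩
      conj (z w) 𝔼.* (M w u 𝔼.* z u)        ∎
      where open 𝔼-Solver using (_:*_; _:=_)

  -- From ω = (-1 + √-3)/2; `√-3` is the prime of norm 3 above 3.
  ω √-3 : ℤ[ω]
  ω   = + 0 +ω + 1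
  √-3 = + 1 +ω + 2

  -- The equation c m = 1 + 3 k says that 3 ∤ m.  Then √-3 divides every
  -- solution z, and the quotient is again a solution: infinite descent.
  √-3-descent : ∀ {n} (M : Fin n → Fin n → ℤ[ω]) q m c k → c * m ≡ + 1 + + 3 * k →
    ∀ (z : Vector ℤ[ω] n) →
    (∀ u → √-3 𝔼.* (∑[ w < n ] (M u w 𝔼.* z w)) ≡ (√-3 𝔼.* q 𝔼.+ (m +ω + 0) 𝔼.* ω) 𝔼.* z u) →
    ∀ u → z u ≡ 𝔼.0#
  √-3-descent {n} M q m c k cm≡1+3k z₀ Mz₀ i = <-rec P step _ z₀ Mz₀ ≡.refl
    where
    IsSolution : Vector ℤ[ω] n → Set
    IsSolution z = ∀ u → √-3 𝔼.* (∑[ w < n ] (M u w 𝔼.* z w)) ≡ (√-3 𝔼.* q 𝔼.+ (m +ω + 0) 𝔼.* ω) 𝔼.* z u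

    -- Induction on the norm of the one coordinate `i`, for all solutions at once, because each
    -- division by `√-3` changes the solution.
    P : ℕ → Set
    P N = ∀ z → IsSolution z → ∣ norm (z i) ∣ ≡ N → z i ≡ 𝔼.0#

    √-3≢0 : √-3 ≢ 𝔼.0#
    √-3≢0 ()

    module _ (z : Vector ℤ[ω] n) (Mz : IsSolution z) where
      y : Vector ℤ[ω] n
      -- As ω³ = 1, the equation gives m z = √-3 ω² (M z - q z). Insert this into z = (c m - 3k) z,
      -- where -3 = (√-3)², and take out one factor `√-3`.
      y u = (c +ω + 0) 𝔼.* (ω 𝔼.* ω) 𝔼.* ((∑[ w < n ] (M u w 𝔼.* z w)) 𝔼.- q 𝔼.* z u) 𝔼.+ √-3 𝔼.* (k +ω + 0) 𝔼.* z u

      z≡√-3y : ∀ u → z u ≡ √-3 𝔼.* y u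
      z≡√-3y u = begin
        z u
          ≡⟨ solve 2 (λ z k → z := (con (+ 1 +ω + 0) :+ con (+ 3 +ω + 0) :* k) :* z :+ con √-3 :* (con √-3 :* k :* z)) ≡.refl (z u) (k +ω + 0) ⟩
        ((+ 1 +ω + 0) 𝔼.+ (+ 3 +ω + 0) 𝔼.* (k +ω + 0)) 𝔼.* z u 𝔼.+ √-3 𝔼.* (√-3 𝔼.* (k +ω + 0) 𝔼.* z u)
          ≡⟨ ≡.cong (λ t → t 𝔼.* z u 𝔼.+ √-3 𝔼.* (√-3 𝔼.* (k +ω + 0) 𝔼.* z u)) cm ⟨
        (c +ω + 0) 𝔼.* (m +ω + 0) 𝔼.* z u 𝔼.+ √-3 𝔼.* (√-3 𝔼.* (k +ω + 0) 𝔼.* z u)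
          ≡⟨ solve 5 (λ c m z q d → c :* m :* z :+ d :=
               c :* (con ω :* con ω) :* ((con √-3 :* q :+ m :* con ω) :* z :- con √-3 :* q :* z) :+ d)
               ≡.refl (c +ω + 0) (m +ω + 0) (z u) q _ ⟩
        (c +ω + 0) 𝔼.* (ω 𝔼.* ω) 𝔼.* ((√-3 𝔼.* q 𝔼.+ (m +ω + 0) 𝔼.* ω) 𝔼.* z u 𝔼.- √-3 𝔼.* q 𝔼.* z u) 𝔼.+ √-3 𝔼.* (√-3 𝔼.* (k +ω + 0) 𝔼.* z u)
          ≡⟨ ≡.cong (λ t → (c +ω + 0) 𝔼.* (ω 𝔼.* ω) 𝔼.* (t 𝔼.- √-3 𝔼.* q 𝔼.* z u) 𝔼.+ √-3 𝔼.* (√-3 𝔼.* (k +ω + 0) 𝔼.* z u)) (Mz u) ⟨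
        (c +ω + 0) 𝔼.* (ω 𝔼.* ω) 𝔼.* (√-3 𝔼.* (∑[ w < n ] (M u w 𝔼.* z w)) 𝔼.- √-3 𝔼.* q 𝔼.* z u) 𝔼.+ √-3 𝔼.* (√-3 𝔼.* (k +ω + 0) 𝔼.* z u)
          ≡⟨ solve 5 (λ c s q z d → c :* (con √-3 :* s :- con √-3 :* q :* z) :+ con √-3 :* d := con √-3 :* (c :* (s :- q :* z) :+ d))
               ≡.refl ((c +ω + 0) 𝔼.* (ω 𝔼.* ω)) _ q (z u) _ ⟩
        √-3 𝔼.* y u ∎
        where
        open ≡.≡-Reasoning
        open 𝔼-Solver
        cm : (c +ω + 0) 𝔼.* (m +ω + 0) ≡ (+ 1 +ω + 0) 𝔼.+ (+ 3 +ω + 0) 𝔼.* (k +ω + 0)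
        cm = ≡.cong₂ _+ω_ (≡.trans (eq₁ c m) (≡.trans cm≡1+3k (eq₂ k))) (≡.trans (eq₃ c m) (eq₄ k))
          where
          eq₁ : ∀ c m → c * m - + 0 * + 0 ≡ c * m
          eq₁ = solve-∀
          eq₂ : ∀ k → + 1 + + 3 * k ≡ + 1 + (+ 3 * k - + 0 * + 0)
          eq₂ = solve-∀
          eq₃ : ∀ c m → c * + 0 + + 0 * m - + 0 * + 0 ≡ + 0
          eq₃ = solve-∀
          eq₄ : ∀ k → + 0 ≡ + 0 + (+ 3 * + 0 + + 0 * k - + 0 * + 0)
          eq₄ = solve-∀

      My : IsSolution y
      -- The system is homogeneous linear in `z`, so substituting √-3 y for `z` and cancelling
      -- leaves the same system.
      My u = *-cancelˡ √-3 √-3≢0 (begin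
        √-3 𝔼.* (√-3 𝔼.* (∑[ w < n ] (M u w 𝔼.* y w)))
          ≡⟨ ≡.cong (√-3 𝔼.*_) (∑𝔼.*-distribˡ-sum √-3 (λ w → M u w 𝔼.* y w)) ⟩
        √-3 𝔼.* (∑[ w < n ] (√-3 𝔼.* (M u w 𝔼.* y w)))
          ≡⟨ ≡.cong (√-3 𝔼.*_) (∑𝔼.sum-cong-≗ (λ w → ≡.trans (swap √-3 (M u w) (y w)) (≡.cong (M u w 𝔼.*_) (≡.sym (z≡√-3y w))))) ⟩
        √-3 𝔼.* (∑[ w < n ] (M u w 𝔼.* z w))
          ≡⟨ Mz u ⟩
        Q 𝔼.* z u
          ≡⟨ ≡.trans (≡.cong (Q 𝔼.*_) (z≡√-3y u)) (swap Q √-3 (y u)) ⟩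
        √-3 𝔼.* (Q 𝔼.* y u) ∎)
        where
        open ≡.≡-Reasoning
        Q : ℤ[ω]
        Q = √-3 𝔼.* q 𝔼.+ (m +ω + 0) 𝔼.* ω
        swap : ∀ x y z → x 𝔼.* (y 𝔼.* z) ≡ y 𝔼.* (x 𝔼.* z)
        swap = 𝔼-Solver.solve 3 (λ x y z → x :* (y :* z) := y :* (x :* z)) ≡.refl
          where open 𝔼-Solver

    step : ∀ N → (∀ {N′} → N′ ℕ.< N → P N′) → P N
    step N rec z Mz ≡.refl with z i ≟ 𝔼.0#
    ... | yes zᵢ≡0 = zᵢ≡0
    ... | no  zᵢ≢0 = ≡.trans (z≡√-3y z Mz i)
      (≡.trans (≡.cong (√-3 𝔼.*_) (rec smaller (y z Mz) (My z Mz) ≡.refl)) (𝔼.zeroʳ √-3))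
      where
      yᵢ≢0 : ∣ norm (y z Mz i) ∣ ≢ 0
      yᵢ≢0 ≡0 = zᵢ≢0 (≡.trans (z≡√-3y z Mz i)
        (≡.trans (≡.cong (√-3 𝔼.*_) (norm≡0⇒≡0 (y z Mz i) (ℤₚ.∣i∣≡0⇒i≡0 ≡0))) (𝔼.zeroʳ √-3)))
      ∣norm∣ : ∣ norm (z i) ∣ ≡ 3 ℕ.* ∣ norm (y z Mz i) ∣
      ∣norm∣ = ≡.trans (≡.cong (∣_∣ ∘ norm) (z≡√-3y z Mz i))
        (≡.trans (≡.cong ∣_∣ (norm-* √-3 (y z Mz i))) (ℤₚ.abs-* (+ 3) (norm (y z Mz i))))
      -- `√-3` has norm 3, so the division leaves a third of the norm, which is strictly less as the
      -- quotient is nonzero.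
      smaller : ∣ norm (y z Mz i) ∣ ℕ.< ∣ norm (z i) ∣
      smaller = ≡.subst (∣ norm (y z Mz i) ∣ ℕ.<_) (≡.sym ∣norm∣)
        (ℕ.m<m+n ∣ norm (y z Mz i) ∣ (ℕ.≤-trans (ℕ.n≢0⇒n>0 yᵢ≢0) (ℕ.m≤m+n _ _)))

open EisensteinIntegers

-- The embedding of ℤ[ω] in the field

module FieldProperties {c ℓ₁ ℓ₂} (K : ComplexField c ℓ₁ ℓ₂) where
  open ComplexField K public
  open CommutativeRing commutativeRing public using (ring; +-abelianGroup)
  open Mult semiring using (×-homo-+; ×1-homo-*)
  open RingProperties ring using (-0#≈0#; -‿distribˡ-*; -‿distribʳ-*; -‿involutive)
  open AbelianGroupProperties +-abelianGroup using () renaming (⁻¹-∙-comm to -‿+-comm)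
  open ≈-Reasoning setoid

  fromℤ-neg : ∀ a → fromℤ (ℤ.- a) ≈ - fromℤ a
  fromℤ-neg (+ zero)  = sym -0#≈0#
  fromℤ-neg (+ suc n) = refl
  fromℤ-neg -[1+ n ]  = sym (-‿involutive _)

  fromℤ-⊖ : ∀ m n → fromℤ (m ℤ.⊖ n) ≈ m · 1# - n · 1#
  fromℤ-⊖ zero    zero    = sym (-‿inverseʳ 0#)
  fromℤ-⊖ zero    (suc n) = sym (+-identityˡ _)
  fromℤ-⊖ (suc m) zero    = sym (trans (+-congˡ -0#≈0#) (+-identityʳ _))
  fromℤ-⊖ (suc m) (suc n) = begin
    fromℤ (suc m ℤ.⊖ suc n)                   ≡⟨ ≡.cong fromℤ (ℤₚ.[1+m]⊖[1+n]≡m⊖n m n) ⟩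
    fromℤ (m ℤ.⊖ n)                           ≈⟨ fromℤ-⊖ m n ⟩
    m · 1# - n · 1#                           ≈⟨ +-congʳ (+-identityˡ _) ⟨
    (0# + m · 1#) - n · 1#                    ≈⟨ +-congʳ (+-congʳ (-‿inverseʳ 1#)) ⟨
    ((1# - 1#) + m · 1#) - n · 1#             ≈⟨ +-congʳ (trans (+-assoc _ _ _) (trans (+-congˡ (+-comm _ _)) (sym (+-assoc _ _ _)))) ⟩
    ((1# + m · 1#) - 1#) - n · 1#             ≈⟨ trans (+-assoc _ _ _) (+-congˡ (-‿+-comm _ _)) ⟩
    suc m · 1# - suc n · 1#                   ∎

  fromℤ-+ : ∀ a b → fromℤ (a ℤ.+ b) ≈ fromℤ a + fromℤ b
  fromℤ-+ (+ m)    (+ n)    = ×-homo-+ 1# m n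
  fromℤ-+ (+ m)    -[1+ n ] = fromℤ-⊖ m (suc n)
  fromℤ-+ -[1+ m ] (+ n)    = trans (fromℤ-⊖ n (suc m)) (+-comm _ _)
  fromℤ-+ -[1+ m ] -[1+ n ] = begin
    - (suc (suc (m ℕ.+ n)) · 1#)     ≡⟨ ≡.cong (λ k → - (k · 1#)) (≡.cong suc (ℕ.+-suc m n)) ⟨
    - ((suc m ℕ.+ suc n) · 1#)       ≈⟨ -‿cong (×-homo-+ 1# (suc m) (suc n)) ⟩
    - (suc m · 1# + suc n · 1#)      ≈⟨ -‿+-comm _ _ ⟨
    - (suc m · 1#) - (suc n · 1#)    ∎

  fromℤ-pos-* : ∀ m b → fromℤ (+ m ℤ.* b) ≈ fromℤ (+ m) * fromℤ b
  fromℤ-pos-* m (+ n)    = trans (reflexive (≡.cong fromℤ (≡.sym (ℤₚ.pos-* m n)))) (×1-homo-* m n)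
  fromℤ-pos-* m -[1+ n ] = begin
    fromℤ (+ m ℤ.* -[1+ n ])          ≡⟨ ≡.cong fromℤ (ℤₚ.neg-distribʳ-* (+ m) (+ suc n)) ⟨
    fromℤ (ℤ.- (+ m ℤ.* + suc n))     ≈⟨ fromℤ-neg (+ m ℤ.* + suc n) ⟩
    - fromℤ (+ m ℤ.* + suc n)         ≈⟨ -‿cong (fromℤ-pos-* m (+ suc n)) ⟩
    - (fromℤ (+ m) * fromℤ (+ suc n)) ≈⟨ -‿distribʳ-* _ _ ⟩
    fromℤ (+ m) * fromℤ -[1+ n ]      ∎

  fromℤ-* : ∀ a b → fromℤ (a ℤ.* b) ≈ fromℤ a * fromℤ b
  fromℤ-* (+ m)    b = fromℤ-pos-* m b
  fromℤ-* -[1+ m ] b = begin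
    fromℤ (-[1+ m ] ℤ.* b)            ≡⟨ ≡.cong fromℤ (ℤₚ.neg-distribˡ-* (+ suc m) b) ⟨
    fromℤ (ℤ.- (+ suc m ℤ.* b))       ≈⟨ fromℤ-neg (+ suc m ℤ.* b) ⟩
    - fromℤ (+ suc m ℤ.* b)           ≈⟨ -‿cong (fromℤ-pos-* (suc m) b) ⟩
    - (fromℤ (+ suc m) * fromℤ b)     ≈⟨ -‿distribˡ-* _ _ ⟩
    fromℤ -[1+ m ] * fromℤ b          ∎

  private
    ℤ-morphism : CommutativeRing.rawRing ℤₚ.+-*-commutativeRing -Raw-AlmostCommutative⟶ fromCommutativeRing commutativeRing
    ℤ-morphism = record
      { ⟦_⟧    = fromℤ
      ; +-homo = fromℤ-+
      ; *-homo = fromℤ-*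
      ; -‿homo = fromℤ-neg
      ; 0-homo = refl
      ; 1-homo = +-identityʳ 1#
      }

  -- Equality in the field is undecidable, so the solver compares coefficients in ℤ. Its constant 1
  -- denotes `1# + 0#`; where the literal `1#` occurs below it is passed as a variable.
  module ℤ-Solver = Algebra.Solver.Ring _ _ ℤ-morphism
    (λ a b → Maybe.map (reflexive ∘ ≡.cong fromℤ) (dec⇒maybe (a ℤₚ.≟ b)))

  ½*2≈1 : ½ * fromℤ (+ 2) ≈ 1#
  ½*2≈1 = trans (*-congˡ (sym (trans (+-congˡ -0#≈0#) (+-identityʳ _))))
                (proj₁ (proj₂ (#⇒invertible (characteristic-0 1))))

  ω₃*ω₃ : ω₃ * ω₃ ≈ - 1# - ω₃
  ω₃*ω₃ = begin
    ω₃ * ω₃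
      ≈⟨ solve 4 (λ o h i s → ((:- o :+ i :* s) :* h) :* ((:- o :+ i :* s) :* h) :=
           h :* h :* (o :* o :- con (+ 2) :* o :* (i :* s) :+ (i :* i) :* (s :* s))) refl 1# ½ i √3 ⟩
    ½ * ½ * (1# * 1# - fromℤ (+ 2) * 1# * (i * √3) + (i * i) * (√3 * √3))
      ≈⟨ *-congˡ (+-congˡ (*-cong i² √3²)) ⟩
    ½ * ½ * (1# * 1# - fromℤ (+ 2) * 1# * (i * √3) + - 1# * fromℤ (+ 3))
      ≈⟨ *-congˡ (+-cong (+-cong 1*1 (-‿cong (*-congʳ (trans (*-identityʳ _) refl)))) (*-congʳ (-‿cong 1≈))) ⟩
    ½ * ½ * (fromℤ (+ 1) - fromℤ (+ 2) * (i * √3) + - fromℤ (+ 1) * fromℤ (+ 3))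
      -- 1 - 2t - 3 = 2(-1 - t), and this 2 cancels one of the two halves.
      ≈⟨ solve 2 (λ h t → h :* h :* (con (+ 1) :- con (+ 2) :* t :+ (:- con (+ 1)) :* con (+ 3)) :=
           (h :* con (+ 2)) :* (h :* (:- con (+ 1) :- t))) refl ½ (i * √3) ⟩
    (½ * fromℤ (+ 2)) * (½ * (- fromℤ (+ 1) - i * √3))
      ≈⟨ *-congʳ ½*2≈1 ⟩
    1# * (½ * (- fromℤ (+ 1) - i * √3))
      ≈⟨ *-identityˡ _ ⟩
    ½ * (- fromℤ (+ 1) - i * √3)
      ≈⟨ solve 2 (λ h t → h :* (:- con (+ 1) :- t) := :- (h :* con (+ 2)) :- (:- con (+ 1) :+ t) :* h) refl ½ (i * √3) ⟩
    - (½ * fromℤ (+ 2)) - (- fromℤ (+ 1) + i * √3) * ½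
      ≈⟨ +-cong (-‿cong ½*2≈1) (-‿cong (*-congʳ (+-congʳ (-‿cong (+-identityʳ 1#))))) ⟩
    - 1# - ω₃ ∎
    where
    open ℤ-Solver
    1≈ : 1# ≈ fromℤ (+ 1)
    1≈ = sym (+-identityʳ 1#)
    1*1 : 1# * 1# ≈ fromℤ (+ 1)
    1*1 = trans (*-identityʳ 1#) 1≈

  ι : ℤ[ω] → Carrier
  ι (a +ω b) = fromℤ a + fromℤ b * ω₃

  ι-+ : ∀ x y → ι (x 𝔼.+ y) ≈ ι x + ι y
  ι-+ (a +ω b) (c +ω d) = trans (+-cong (fromℤ-+ a c) (*-congʳ (fromℤ-+ b d)))
    (solve 5 (λ a b c d w → a :+ c :+ (b :+ d) :* w := a :+ b :* w :+ (c :+ d :* w)) refl _ _ _ _ _)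
    where open ℤ-Solver

  ι-neg : ∀ x → ι (𝔼.- x) ≈ - ι x
  ι-neg (a +ω b) = trans (+-cong (fromℤ-neg a) (*-congʳ (fromℤ-neg b)))
    (solve 3 (λ a b w → :- a :+ (:- b) :* w := :- (a :+ b :* w)) refl _ _ _)
    where open ℤ-Solver

  ι-* : ∀ x y → ι (x 𝔼.* y) ≈ ι x * ι y
  ι-* (a +ω b) (c +ω d) = begin
    fromℤ (a ℤ.* c ℤ.- b ℤ.* d) + fromℤ (a ℤ.* d ℤ.+ b ℤ.* c ℤ.- b ℤ.* d) * ω₃
      ≈⟨ +-cong (fromℤ-- (a ℤ.* c) (b ℤ.* d) (fromℤ-* a c) (fromℤ-* b d))
           (*-congʳ (fromℤ-- (a ℤ.* d ℤ.+ b ℤ.* c) (b ℤ.* d) (trans (fromℤ-+ (a ℤ.* d) (b ℤ.* c)) (+-cong (fromℤ-* a d) (fromℤ-* b c))) (fromℤ-* b d))) ⟩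
    (A * C - B * D) + (A * D + B * C - B * D) * ω₃
      -- Factors `1#` are inserted so that the solver, with `1#` as a variable, can split off
      -- `- 1# - ω₃`, which is then replaced by `ω₃ * ω₃`.
      ≈⟨ +-congʳ (+-congʳ (*-identityʳ _)) ⟨
    (A * C * 1# - B * D) + (A * D + B * C - B * D) * ω₃
      ≈⟨ +-congʳ (+-cong (*-identityʳ _) (-‿cong (*-identityʳ _))) ⟨
    (A * C * 1# * 1# - B * D * 1#) + (A * D + B * C - B * D) * ω₃
      ≈⟨ solve 6 (λ A B C D o w → (A :* C :* o :* o :- B :* D :* o) :+ (A :* D :+ B :* C :- B :* D) :* w :=
           A :* C :* o :* o :+ (A :* D :+ B :* C) :* w :+ B :* D :* (:- o :- w)) refl A B C D 1# ω₃ ⟩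
    A * C * 1# * 1# + (A * D + B * C) * ω₃ + B * D * (- 1# - ω₃)
      ≈⟨ +-cong (+-congʳ (trans (*-identityʳ _) (*-identityʳ _))) (*-congˡ (sym ω₃*ω₃)) ⟩
    A * C + (A * D + B * C) * ω₃ + B * D * (ω₃ * ω₃)
      ≈⟨ solve 5 (λ A B C D w → A :* C :+ (A :* D :+ B :* C) :* w :+ B :* D :* (w :* w) :=
           (A :+ B :* w) :* (C :+ D :* w)) refl A B C D ω₃ ⟩
    (A + B * ω₃) * (C + D * ω₃) ∎
    where
    open ℤ-Solver
    A B C D : Carrier
    A = fromℤ a
    B = fromℤ b
    C = fromℤ c
    D = fromℤ d
    fromℤ-- : ∀ i j {x y} → fromℤ i ≈ x → fromℤ j ≈ y → fromℤ (i ℤ.- j) ≈ x - y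
    fromℤ-- i j i≈ j≈ = trans (fromℤ-+ i (ℤ.- j)) (+-cong i≈ (trans (fromℤ-neg j) (-‿cong j≈)))

  ι-fromℤ : ∀ a → ι (a +ω + 0) ≈ fromℤ a
  ι-fromℤ a = trans (+-congˡ (zeroˡ ω₃)) (+-identityʳ _)

  ι-1 : ι 𝔼.1# ≈ 1#
  ι-1 = trans (ι-fromℤ (+ 1)) (+-identityʳ 1#)

  ι-0 : ι 𝔼.0# ≈ 0#
  ι-0 = ι-fromℤ (+ 0)

  private
    𝔼-morphism : CommutativeRing.rawRing 𝔼-commutativeRing -Raw-AlmostCommutative⟶ fromCommutativeRing commutativeRing
    𝔼-morphism = record
      { ⟦_⟧ = ι ; +-homo = ι-+ ; *-homo = ι-* ; -‿homo = ι-neg ; 0-homo = ι-0 ; 1-homo = ι-1 }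

  -- With coefficients in ℤ[ω], identities between fixed elements such as `ω₆`, `ω̄₆` and `√-3` are
  -- settled by computation.
  module K-Solver = Algebra.Solver.Ring _ _ 𝔼-morphism
    (λ x y → Maybe.map (reflexive ∘ ≡.cong ι) (dec⇒maybe (x ≟ y)))

  #-resp : ∀ {x y} → x ≈ y → x # 0# → y # 0#
  #-resp {x} {y} x≈y x#0 = let z , zl , zr = #⇒invertible x#0 in
    invertible⇒# (z , trans (*-congˡ (+-congʳ (sym x≈y))) zl , trans (*-congʳ (+-congʳ (sym x≈y))) zr)

  x*y≈1⇒x#0 : ∀ {x y} → x * y ≈ 1# → x # 0#
  x*y≈1⇒x#0 {x} {y} xy≈1 = invertible⇒# (y , trans (*-comm _ _) left , left)
    where
    left : (x - 0#) * y ≈ 1#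
    left = trans (*-congʳ (trans (+-congˡ -0#≈0#) (+-identityʳ x))) xy≈1

  inverse : ∀ {x} → x # 0# → ∃[ y ] x * y ≈ 1#
  inverse {x} x#0 = let y , _ , xy≈1 = #⇒invertible x#0 in
    y , trans (*-congʳ (sym (trans (+-congˡ -0#≈0#) (+-identityʳ x)))) xy≈1

  x*y#0⇒x#0 : ∀ {x y} → x * y # 0# → x # 0#
  x*y#0⇒x#0 xy#0 = let z , eq = inverse xy#0 in x*y≈1⇒x#0 (trans (sym (*-assoc _ _ _)) eq)

  *-cancel-0 : ∀ {x y} → x # 0# → x * y ≈ 0# → y ≈ 0#
  *-cancel-0 {x} {y} x#0 xy≈0 = let z , xz≈1 = inverse x#0 in begin
    y            ≈⟨ *-identityˡ y ⟨
    1# * y       ≈⟨ *-congʳ xz≈1 ⟨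
    x * z * y    ≈⟨ trans (*-congʳ (*-comm x z)) (*-assoc z x y) ⟩
    z * (x * y)  ≈⟨ *-congˡ xy≈0 ⟩
    z * 0#       ≈⟨ zeroʳ z ⟩
    0#           ∎

  *-cancel-# : ∀ {x y z} → z # 0# → x * z ≈ y * z → x ≈ y
  *-cancel-# {x} {y} {z} z#0 xz≈yz = let w , zw≈1 = inverse z#0 in begin
    x            ≈⟨ *-identityʳ x ⟨
    x * 1#       ≈⟨ *-congˡ zw≈1 ⟨
    x * (z * w)  ≈⟨ *-assoc x z w ⟨
    x * z * w    ≈⟨ *-congʳ xz≈yz ⟩
    y * z * w    ≈⟨ *-assoc y z w ⟩
    y * (z * w)  ≈⟨ *-congˡ zw≈1 ⟩
    y * 1#       ≈⟨ *-identityʳ y ⟩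
    y            ∎

  1#0 : 1# # 0#
  1#0 = x*y≈1⇒x#0 (*-identityʳ 1#)

  fromℤ-# : ∀ a → a ≢ + 0 → fromℤ a # 0#
  fromℤ-# (+ zero)  a≢0 = contradiction ≡.refl a≢0
  fromℤ-# (+ suc n) _   = characteristic-0 n
  fromℤ-# -[1+ n ]  _   = let z , eq = inverse (characteristic-0 n) in
    x*y≈1⇒x#0 {y = - z} (trans (sym (-‿distribˡ-* _ _)) (trans (-‿cong (sym (-‿distribʳ-* _ _))) (trans (-‿involutive _) eq)))

  -- x times its conjugate is a nonzero integer, invertible in characteristic 0, so its factor `ι x`
  -- is invertible too.
  ι-# : ∀ x → x ≢ 𝔼.0# → ι x # 0#
  ι-# x x≢0 = x*y#0⇒x#0 (#-resp eq (fromℤ-# (norm x) (x≢0 ∘ norm≡0⇒≡0 x)))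
    where
    eq : fromℤ (norm x) ≈ ι x * ι (conj x)
    eq = trans (sym (ι-fromℤ (norm x))) (trans (reflexive (≡.cong ι (≡.sym (*-conj x)))) (ι-* x (conj x)))

  ≈0⇒¬# : ∀ {x} → x ≈ 0# → ¬ x # 0#
  ≈0⇒¬# {x} = proj₂ (tight x 0#)

  ι-injective : ∀ {x y} → ι x ≈ ι y → x ≡ y
  ι-injective {x} {y} ιx≈ιy with x ≟ y
  ... | yes x≡y = x≡y
  ... | no  x≢y = contradiction (ι-# (x 𝔼.- y) (x≢y ∘ RingProperties.x∙y⁻¹≈ε⇒x≈y 𝔼.ring x y)) (≈0⇒¬# (begin
    ι (x 𝔼.- y)    ≈⟨ trans (ι-+ x (𝔼.- y)) (+-cong ιx≈ιy (ι-neg y)) ⟩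
    ι y - ι y      ≈⟨ -‿inverseʳ _ ⟩
    0#             ∎))

-- Linear algebra over the field

module LinearAlgebra {c ℓ₁ ℓ₂} (K : ComplexField c ℓ₁ ℓ₂) where
  open FieldProperties K public hiding (zero)
  open Sum semiring using (sum; sum-cong-≋; ∑-comm; ∑-distrib-+; *-distribˡ-sum; *-distribʳ-sum)
  open SumProperties commutativeRing
  open RingProperties ring using (-‿distribˡ-*; -‿distribʳ-*)
  open ≈-Reasoning setoid

  NonZero : ∀ {n} → Pred (Vector Carrier n) _
  NonZero v = ∃[ k ] v k # 0#

  -- By tightness of apartness. It extracts equations from the negative branch of a case split on
  -- `NonZero`.
  ¬NonZero⇒≈0 : ∀ {n} {v : Vector Carrier n} → ¬ NonZero v → ∀ k → v k ≈ 0#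
  ¬NonZero⇒≈0 {v = v} ¬v k = proj₁ (tight (v k) 0#) (λ vₖ#0 → ¬v (k , vₖ#0))

  -- One step of Gaussian elimination: vector `x zero`, with pivot in coordinate `k`, clears that
  -- coordinate in the others, which is then deleted. A dependence among the reduced vectors lifts
  -- back.
  module Elimination {n} (x : Fin (suc (suc n)) → Vector Carrier (suc n))
    (k : Fin (suc n)) (p : Carrier) (x₀ₖp≈1 : x zero k * p ≈ 1#) where

    eliminated : Fin (suc n) → Vector Carrier n
    eliminated i j = x (suc i) (punchIn k j) + x (suc i) k * - (p * x zero (punchIn k j))

    module _ (a : Vector Carrier (suc n)) where
      S : Vector Carrier (suc n)
      S k′ = ∑[ i < suc n ] (a i * x (suc i) k′)

      back-substitute : Vector Carrier (suc (suc n))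
      -- The coefficient of `x zero` is the one that makes coordinate `k` of the combination vanish.
      back-substitute = - (S k * p) Vector.∷ a

      pivot-row : - (S k * p) * x zero k + S k ≈ 0#
      pivot-row = begin
        - (S k * p) * x zero k + S k    ≈⟨ solve 3 (λ s p x → (:- (s :* p)) :* x :+ s := :- (s :* (x :* p)) :+ s) refl (S k) p (x zero k) ⟩
        - (S k * (x zero k * p)) + S k  ≈⟨ +-congʳ (-‿cong (trans (*-congˡ x₀ₖp≈1) (*-identityʳ _))) ⟩
        - S k + S k                     ≈⟨ -‿inverseˡ _ ⟩
        0#                              ∎
        where open K-Solver

      other-row : ∀ j → ∑[ i < suc n ] (a i * eliminated i j) ≈ 0# →
                  - (S k * p) * x zero (punchIn k j) + S (punchIn k j) ≈ 0#
      other-row j a≈0 = begin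
        - (S k * p) * x zero k′ + S k′
          ≈⟨ solve 4 (λ s p x t → (:- (s :* p)) :* x :+ t := t :+ s :* (:- (p :* x))) refl (S k) p (x zero k′) (S k′) ⟩
        S k′ + S k * q
          ≈⟨ sum-+-* (λ i → a i * x (suc i) k′) (λ i → a i * x (suc i) k) q ⟨
        ∑[ i < suc n ] (a i * x (suc i) k′ + a i * x (suc i) k * q)
          ≈⟨ sum-cong-≋ factor ⟩
        ∑[ i < suc n ] (a i * eliminated i j)
          ≈⟨ a≈0 ⟩
        0# ∎
        where
        open K-Solver
        k′ : Fin (suc n)
        k′ = punchIn k j
        q : Carrier
        q = - (p * x zero k′)
        factor : ∀ i → a i * x (suc i) k′ + a i * x (suc i) k * q ≈ a i * eliminated i j
        factor i = trans (+-congˡ (*-assoc _ _ _)) (sym (distribˡ _ _ _))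

      solves : (∀ j → ∑[ i < suc n ] (a i * eliminated i j) ≈ 0#) →
               ∀ k′ → ∑[ i < suc (suc n) ] (back-substitute i * x i k′) ≈ 0#
      solves a≈0 k′ with k Fin.≟ k′
      ... | yes ≡.refl = pivot-row
      ... | no  k≢k′   = ≡.subst (λ k′ → - (S k * p) * x zero k′ + S k′ ≈ 0#)
                           (Fin.punchIn-punchOut k≢k′) (other-row (punchOut k≢k′) (a≈0 _))

  -- Either the first vector vanishes and is by itself a dependence, or it has a pivot and
  -- elimination lowers the dimension. This case split is why the result is doubly negated.
  linearly-dependent : ∀ n (x : Fin (suc n) → Vector Carrier n) →
    ¬ ¬ (∃[ a ] NonZero a × (∀ k → ∑[ i < suc n ] (a i * x i k) ≈ 0#))
  linearly-dependent zero    x ¬dep = ¬dep ((λ _ → 1#) , (zero , 1#0) , λ ())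
  linearly-dependent (suc n) x ¬dep = ¬¬-excluded-middle λ
    { (no  x₀≈0) → ¬dep (1# Vector.∷ (λ _ → 0#) , (zero , 1#0) , λ k →
        trans (+-cong (trans (*-identityˡ _) (¬NonZero⇒≈0 x₀≈0 k))
                      (sum-zero (λ i → 0# * x (suc i) k) (λ i → zeroˡ _)))
              (+-identityʳ 0#))
    ; (yes (k , x₀ₖ#0)) →
        let p , x₀ₖp≈1 = inverse x₀ₖ#0
            open Elimination x k p x₀ₖp≈1
        in linearly-dependent n eliminated λ (a , (i , aᵢ#0) , a≈0) →
             ¬dep (back-substitute a , (suc i , aᵢ#0) , solves a a≈0) }

  -- Eigenvectors in invariant subspaces.

  record IsLinear {n} (T : Vector Carrier n → Vector Carrier n) : Set (c ⊔ ℓ₁) where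
    field
      cong   : ∀ {v w} → (∀ k → v k ≈ w k) → ∀ k → T v k ≈ T w k
      homo-+ : ∀ v w k → T (λ k → v k + w k) k ≈ T v k + T w k
      homo-* : ∀ a v k → T (λ k → a * v k) k ≈ a * T v k

  record IsSubspace {n p} (P : Pred (Vector Carrier n) p) : Set (c ⊔ p) where
    field
      +-closed : ∀ {v w} → P v → P w → P (λ k → v k + w k)
      *-closed : ∀ a {v} → P v → P (λ k → a * v k)

  -- The vector a of length d stands for the monic polynomial
  -- x ^ d + ∑ aₖ x ^ k, evaluated by Horner's rule.

  eval : ∀ {d} → Vector Carrier d → Carrier → Carrier
  eval {zero}  a x = 1#
  eval {suc d} a x = a zero + x * eval (tail a) x

  eval-sum : ∀ d (a : Vector Carrier d) x → eval a x ≈ x ^ d + (∑[ k < d ] (a k * x ^ toℕ k))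
  eval-sum zero    a x = sym (+-identityʳ 1#)
  eval-sum (suc d) a x = begin
    a zero + x * eval (tail a) x
      ≈⟨ +-congˡ (*-congˡ (eval-sum d (tail a) x)) ⟩
    a zero + x * (x ^ d + S)
      ≈⟨ solve 4 (λ a x p s → a :+ x :* (p :+ s) := x :* p :+ (a :+ x :* s)) refl (a zero) x (x ^ d) S ⟩
    x ^ suc d + (a zero + x * S)
      ≈⟨ +-congˡ (+-cong (sym (*-identityʳ _)) (trans (*-distribˡ-sum x (λ k → a (suc k) * x ^ toℕ k))
           (sum-cong-≋ shift))) ⟩
    x ^ suc d + (a zero * 1# + (∑[ k < d ] (a (suc k) * x ^ toℕ (suc k)))) ∎
    where
    open K-Solver
    S : Carrier
    S = ∑[ k < d ] (a (suc k) * x ^ toℕ k)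
    shift : ∀ k → x * (a (suc k) * x ^ toℕ k) ≈ a (suc k) * x ^ toℕ (suc k)
    shift k = trans (sym (*-assoc _ _ _)) (trans (*-congʳ (*-comm _ _)) (*-assoc _ _ _))

  -- The quotient of the polynomial a by x - r.
  quotient : ∀ {d} → Vector Carrier (suc d) → Carrier → Vector Carrier d
  quotient {zero}  a r = λ ()
  quotient {suc d} a r = eval (tail a) r Vector.∷ quotient (tail a) r

  module Eigenvectors {n} (T : Vector Carrier n → Vector Carrier n) (T-linear : IsLinear T) where
    open IsLinear T-linear

    apply : ∀ {d} → Vector Carrier d → Vector Carrier n → Vector Carrier n
    apply {zero}  a v = v
    apply {suc d} a v k = a zero * v k + apply (tail a) (T v) k

    -- The identity (x - r) q(x) + p(r) = p(x), with T in place of x and applied to `v`; terms are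
    -- moved across to avoid subtraction.
    factor-theorem : ∀ {d} (a : Vector Carrier (suc d)) r v k →
      T (apply (quotient a r) v) k + eval a r * v k ≈ r * apply (quotient a r) v k + apply a v k
    factor-theorem {zero} a r v k =
      solve 5 (λ t a r v o → t :+ (a :+ r :* o) :* v := r :* (o :* v) :+ (a :* v :+ t)) refl (T v k) (a zero) r (v k) 1#
      ⟨ trans ⟩ +-congʳ (*-congˡ (*-identityˡ _))
      where open K-Solver
    factor-theorem {suc d} a r v k = begin
      T (λ k → e * v k + q k) k + (a zero + r * e) * v k
        ≈⟨ +-congʳ (trans (homo-+ (λ k → e * v k) q k) (+-congʳ (homo-* e v k))) ⟩
      e * T v k + T q k + (a zero + r * e) * v k
        ≈⟨ solve 6 (λ e t q a r v → e :* t :+ q :+ (a :+ r :* e) :* v := q :+ e :* t :+ (a :+ r :* e) :* v) refl e (T v k) (T q k) (a zero) r (v k) ⟩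
      T q k + e * T v k + (a zero + r * e) * v k
        ≈⟨ +-congʳ (factor-theorem (tail a) r (T v) k) ⟩
      r * q k + apply (tail a) (T v) k + (a zero + r * e) * v k
        ≈⟨ solve 6 (λ r q p a e v → r :* q :+ p :+ (a :+ r :* e) :* v := r :* (e :* v :+ q) :+ (a :* v :+ p)) refl r (q k) (apply (tail a) (T v) k) (a zero) e (v k) ⟩
      r * (e * v k + q k) + (a zero * v k + apply (tail a) (T v) k) ∎
      where
      open K-Solver
      e : Carrier
      e = eval (tail a) r
      q : Vector Carrier n
      q = apply (quotient (tail a) r) (T v)

    _HasEigenvector : ∀ {p} → Pred (Vector Carrier n) p → Set _
    P HasEigenvector = ∃[ r ] ∃[ w ] P w × NonZero w × (∀ k → T w k ≈ r * w k)

    module _ {p} {P : Pred (Vector Carrier n) p} (P-subspace : IsSubspace P)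
             (T-closed : ∀ {v} → P v → P (T v)) where
      open IsSubspace P-subspace

      apply-closed : ∀ {d} (a : Vector Carrier d) {v} → P v → P (apply a v)
      apply-closed {zero}  a Pv = Pv
      apply-closed {suc d} a Pv = +-closed (*-closed (a zero) Pv) (apply-closed (tail a) (T-closed Pv))

      -- Take a root r of p and write p = (x - r) q. If q(T) v is nonzero it is an eigenvector for
      -- r; otherwise q annihilates `v` and has lower degree. Degree 0 would force `v` to vanish.
      annihilated⇒eigenvector : ∀ d (a : Vector Carrier d) {v} → P v → NonZero v →
        (∀ k → apply a v k ≈ 0#) → ¬ ¬ (P HasEigenvector)
      annihilated⇒eigenvector zero    a Pv (k , vₖ#0) v≈0 _ = ≈0⇒¬# (v≈0 k) vₖ#0
      annihilated⇒eigenvector (suc d) a {v} Pv v≢0 av≈0 ¬eig = ¬¬-excluded-middle λ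
        { (yes qv≢0) → ¬eig (r , apply q v , apply-closed q Pv , qv≢0 , eigen)
        ; (no  qv≈0) → annihilated⇒eigenvector d q Pv v≢0 (¬NonZero⇒≈0 qv≈0) ¬eig }
        where
        root : ∃[ r ] (r ^ suc d + (∑[ k < suc d ] (a k * r ^ toℕ k))) ≈ 0#
        root = algebraicallyClosed d a
        r : Carrier
        r = proj₁ root
        q : Vector Carrier d
        q = quotient a r
        eigen : ∀ k → T (apply q v) k ≈ r * apply q v k
        eigen k = begin
          T (apply q v) k                      ≈⟨ +-identityʳ _ ⟨
          T (apply q v) k + 0#                 ≈⟨ +-congˡ (trans (*-congʳ (trans (eval-sum (suc d) a r) (proj₂ root))) (zeroˡ _)) ⟨
          T (apply q v) k + eval a r * v k     ≈⟨ factor-theorem a r v k ⟩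
          r * apply q v k + apply a v k        ≈⟨ trans (+-congˡ (av≈0 k)) (+-identityʳ _) ⟩
          r * apply q v k                      ∎

      power : ℕ → Vector Carrier n → Vector Carrier n
      power zero    v = v
      power (suc m) v = power m (T v)

      combination : ∀ {m} → Vector Carrier m → Vector Carrier n → Vector Carrier n
      combination {m} a v k = ∑[ i < m ] (a i * power (toℕ i) v k)

      -- Discard vanishing top coefficients and divide by the first one apart from 0. Finding it
      -- needs excluded middle, hence the double negation.
      make-monic : ∀ {m} (a : Vector Carrier m) → NonZero a →
        ¬ ¬ (∃[ d ] Σ[ b ∈ Vector Carrier d ] ∃[ l ] l # 0# × (∀ v k → combination a v k ≈ l * apply b v k))
      make-monic {suc m} a (i , aᵢ#0) ¬monic = ¬¬-excluded-middle λ
        { (yes a′≢0) → make-monic (tail a) a′≢0 λ (d , b , l , l#0 , eq) →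
            let l⁻¹ , l*l⁻¹≈1 = inverse l#0 in
            ¬monic (suc d , (a zero * l⁻¹) Vector.∷ b , l , l#0 , λ v k → begin
              a zero * v k + combination (tail a) (T v) k
                ≈⟨ +-cong (sym (trans (*-congʳ l*l⁻¹≈1) (*-identityˡ _))) (eq (T v) k) ⟩
              l * l⁻¹ * (a zero * v k) + l * apply b (T v) k
                ≈⟨ solve 5 (λ l i a v b → l :* i :* (a :* v) :+ l :* b := l :* (a :* i :* v :+ b)) refl l l⁻¹ (a zero) (v k) (apply b (T v) k) ⟩
              l * (a zero * l⁻¹ * v k + apply b (T v) k) ∎)
        ; (no  a′≈0) → ¬monic (zero , (λ ()) , a zero , head#0 i aᵢ#0 a′≈0 , λ v k →
            trans (+-congˡ (sum-zero (λ j → a (suc j) * power (toℕ j) (T v) k)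
                                     (λ j → trans (*-congʳ (¬NonZero⇒≈0 a′≈0 j)) (zeroˡ _))))
                  (+-identityʳ _)) }
        where
        open K-Solver
        head#0 : ∀ i → a i # 0# → ¬ NonZero (tail a) → a zero # 0#
        head#0 zero    a₀#0 _    = a₀#0
        head#0 (suc i) aᵢ#0 a′≈0 = contradiction (i , aᵢ#0) a′≈0

      -- The n + 1 vectors v, T v, ..., Tⁿ v are dependent, which is to say that a nonzero
      -- polynomial in T annihilates `v`.
      eigenvector : ∀ {v} → P v → NonZero v → ¬ ¬ (P HasEigenvector)
      eigenvector {v} Pv v≢0 ¬eig =
        linearly-dependent n (λ i → power (toℕ i) v) λ (a , a≢0 , av≈0) →
        make-monic a a≢0 λ (d , b , l , l#0 , eq) →
        annihilated⇒eigenvector d b Pv v≢0 (λ k → *-cancel-0 l#0 (trans (sym (eq v k)) (av≈0 k))) ¬eig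

  -- A nonzero ℤ[ω]-linear functional on the span of v: the vector of its
  -- values satisfies every ℤ[ω]-linear relation that v does.
  ℤ[ω]-point : ∀ {n} (v : Vector Carrier n) → NonZero v →
    ¬ ¬ (Σ[ z ∈ Vector ℤ[ω] n ] (∃[ k ] z k ≢ 𝔼.0#) ×
         (∀ (r : Vector ℤ[ω] n) → ∑[ k < n ] (ι (r k) * v k) ≈ 0# → ∑𝔼.sum (λ k → r k 𝔼.* z k) ≡ 𝔼.0#))
  ℤ[ω]-point {suc n} v v≢0 ¬pt = ¬¬-excluded-middle λ
    -- Only the head coordinate is nonzero, so every relation has head coefficient 0.
    { (no  v′≈0) → ¬pt (𝔼.1# Vector.∷ (λ _ → 𝔼.0#) , (zero , λ ()) , only-head v′≈0)
    ; (yes v′≢0) → ℤ[ω]-point (tail v) v′≢0 λ (z , (j , zⱼ≢0) , rel) →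
        ¬¬-excluded-middle {A = HeadRelation} λ
        -- No relation involves the head coordinate, so its value is free; 0 is chosen.
        { (no  ¬r₀) → ¬pt (𝔼.0# Vector.∷ z , (suc j , zⱼ≢0) , free-head z rel ¬r₀)
        -- The relation `r` prescribes the head value -(∑ rₖ zₖ)/r₀; scaling the whole vector by r₀
        -- keeps it in ℤ[ω].
        ; (yes (r , r₀≢0 , rv≈0)) → ¬pt (𝔼.- (∑𝔼.sum (λ k → r (suc k) 𝔼.* z k)) Vector.∷ (λ k → r zero 𝔼.* z k) ,
            (suc j , zⱼ≢0 ∘ x*y≡0⇒y≡0 (r zero) (z j) r₀≢0) , dependent-head z rel r rv≈0) } }
    where
    HeadRelation : Set _
    HeadRelation = Σ[ r ∈ Vector ℤ[ω] (suc n) ] r zero ≢ 𝔼.0# × ∑[ k < suc n ] (ι (r k) * v k) ≈ 0#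

    Relations⊆ : Vector ℤ[ω] n → Set _
    Relations⊆ z = ∀ (r : Vector ℤ[ω] n) → ∑[ k < n ] (ι (r k) * v (suc k)) ≈ 0# → ∑𝔼.sum (λ k → r k 𝔼.* z k) ≡ 𝔼.0#

    only-head : ¬ NonZero (tail v) → ∀ (r : Vector ℤ[ω] (suc n)) → ∑[ k < suc n ] (ι (r k) * v k) ≈ 0# →
      r zero 𝔼.* 𝔼.1# 𝔼.+ ∑𝔼.sum (λ k → r (suc k) 𝔼.* 𝔼.0#) ≡ 𝔼.0#
    only-head v′≈0 r rv≈0 = ≡.trans
      (≡.cong₂ 𝔼._+_ (≡.trans (𝔼.*-identityʳ (r zero)) r₀≡0)
                     (∑𝔼.sum-zero (λ k → r (suc k) 𝔼.* 𝔼.0#) (λ k → 𝔼.zeroʳ (r (suc k)))))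
      (𝔼.+-identityʳ 𝔼.0#)
      where
      head#0 : ∀ {k} → v k # 0# → v zero # 0#
      head#0 {zero}  v₀#0 = v₀#0
      head#0 {suc k} vₖ#0 = contradiction (k , vₖ#0) v′≈0
      v₀ι≈0 : v zero * ι (r zero) ≈ 0#
      v₀ι≈0 = begin
        v zero * ι (r zero)       ≈⟨ trans (*-comm _ _) (sym (+-identityʳ _)) ⟩
        ι (r zero) * v zero + 0#
          ≈⟨ +-congˡ (sum-zero (λ k → ι (r (suc k)) * v (suc k)) (λ k → trans (*-congˡ (¬NonZero⇒≈0 v′≈0 k)) (zeroʳ _))) ⟨
        ∑[ k < suc n ] (ι (r k) * v k)  ≈⟨ rv≈0 ⟩
        0# ∎
      r₀≡0 : r zero ≡ 𝔼.0#
      r₀≡0 = ι-injective (trans (*-cancel-0 (head#0 (proj₂ v≢0)) v₀ι≈0) (sym ι-0))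

    free-head : ∀ z → Relations⊆ z → ¬ HeadRelation → ∀ r → ∑[ k < suc n ] (ι (r k) * v k) ≈ 0# →
      r zero 𝔼.* 𝔼.0# 𝔼.+ ∑𝔼.sum (λ k → r (suc k) 𝔼.* z k) ≡ 𝔼.0#
    free-head z rel ¬r₀ r rv≈0 with r zero ≟ 𝔼.0#
    ... | no  r₀≢0 = contradiction (r , r₀≢0 , rv≈0) ¬r₀
    ... | yes r₀≡0 = ≡.trans (≡.cong₂ 𝔼._+_ (𝔼.zeroʳ (r zero)) (rel (tail r) r′v′≈0)) (𝔼.+-identityʳ 𝔼.0#)
      where
      r′v′≈0 : ∑[ k < n ] (ι (r (suc k)) * v (suc k)) ≈ 0#
      r′v′≈0 = begin
        ∑[ k < n ] (ι (r (suc k)) * v (suc k))       ≈⟨ +-identityˡ _ ⟨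
        0# + (∑[ k < n ] (ι (r (suc k)) * v (suc k)))
          ≈⟨ +-congʳ (trans (*-congʳ (trans (reflexive (≡.cong ι r₀≡0)) ι-0)) (zeroˡ _)) ⟨
        ∑[ k < suc n ] (ι (r k) * v k)               ≈⟨ rv≈0 ⟩
        0# ∎

    dependent-head : ∀ z → Relations⊆ z → ∀ r → ∑[ k < suc n ] (ι (r k) * v k) ≈ 0# →
      ∀ q → ∑[ k < suc n ] (ι (q k) * v k) ≈ 0# →
      q zero 𝔼.* (𝔼.- ∑𝔼.sum (λ k → r (suc k) 𝔼.* z k)) 𝔼.+ ∑𝔼.sum (λ k → q (suc k) 𝔼.* (r zero 𝔼.* z k)) ≡ 𝔼.0#
    dependent-head z rel r rv≈0 q qv≈0 = ≡.trans (≡.sym rearranged) (rel s s-relation)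
      where
      s : Vector ℤ[ω] n
      -- In r₀ q - q₀ r the head coefficient cancels, leaving a relation of the tail.
      s k = r zero 𝔼.* q (suc k) 𝔼.- q zero 𝔼.* r (suc k)

      ι-s : ∀ k → ι (s k) ≈ ι (r zero) * ι (q (suc k)) - ι (q zero) * ι (r (suc k))
      ι-s k = trans (ι-+ (r zero 𝔼.* q (suc k)) (𝔼.- (q zero 𝔼.* r (suc k))))
        (+-cong (ι-* (r zero) (q (suc k))) (trans (ι-neg (q zero 𝔼.* r (suc k))) (-‿cong (ι-* (q zero) (r (suc k))))))

      s-relation : ∑[ k < n ] (ι (s k) * v (suc k)) ≈ 0#
      s-relation = begin
        ∑[ k < n ] (ι (s k) * v (suc k))
          ≈⟨ sum-cong-≋ (λ k → *-congʳ {v (suc k)} (ι-s k)) ⟩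
        ∑[ k < n ] ((ι (r zero) * ι (q (suc k)) - ι (q zero) * ι (r (suc k))) * v (suc k))
          ≈⟨ sum-linear (ι (r zero)) (ι (q zero)) (ι ∘ tail q) (ι ∘ tail r) (tail v) ⟩
        ι (r zero) * Q - ι (q zero) * R
          ≈⟨ solve 5 (λ r Q q R v → r :* Q :- q :* R := r :* (q :* v :+ Q) :- q :* (r :* v :+ R)) refl (ι (r zero)) Q (ι (q zero)) R (v zero) ⟩
        ι (r zero) * (ι (q zero) * v zero + Q) - ι (q zero) * (ι (r zero) * v zero + R)
          ≈⟨ +-cong (trans (*-congˡ qv≈0) (zeroʳ _)) (-‿cong (trans (*-congˡ rv≈0) (zeroʳ _))) ⟩
        0# - 0# ≈⟨ -‿inverseʳ 0# ⟩
        0# ∎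
        where
        open K-Solver
        Q R : Carrier
        Q = ∑[ k < n ] (ι (q (suc k)) * v (suc k))
        R = ∑[ k < n ] (ι (r (suc k)) * v (suc k))

      rearranged : ∑𝔼.sum (λ k → s k 𝔼.* z k) ≡
        q zero 𝔼.* (𝔼.- ∑𝔼.sum (λ k → r (suc k) 𝔼.* z k)) 𝔼.+ ∑𝔼.sum (λ k → q (suc k) 𝔼.* (r zero 𝔼.* z k))
      rearranged = ≡.trans (∑𝔼.sum-linear (r zero) (q zero) (tail q) (tail r) z)
        (≡.trans (𝔼-Solver.solve 4 (λ r Q q R → r :* Q :- q :* R := q :* (:- R) :+ r :* Q) ≡.refl (r zero) Q (q zero) R)
          (≡.cong (q zero 𝔼.* (𝔼.- R) 𝔼.+_) (≡.trans (∑𝔼.*-distribˡ-sum (r zero) (λ k → q (suc k) 𝔼.* z k))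
            (∑𝔼.sum-cong-≗ (λ k → 𝔼-Solver.solve 3 (λ r q z → r :* (q :* z) := q :* (r :* z)) ≡.refl (r zero) (q (suc k)) (z k))))))
        where
        open 𝔼-Solver using (_:*_; _:+_; _:-_; :-_; _:=_)
        Q R : ℤ[ω]
        Q = ∑𝔼.sum (λ k → q (suc k) 𝔼.* z k)
        R = ∑𝔼.sum (λ k → r (suc k) 𝔼.* z k)

  -- Matrices over ℤ[ω] acting on vectors over the field.

  infixr 8 _⊙_

  _⊙_ : ∀ {n} → (Fin n → Fin n → ℤ[ω]) → Vector Carrier n → Vector Carrier n
  _⊙_ {n} M v u = ∑[ w < n ] (ι (M u w) * v w)

  ⊙-linear : ∀ {n} (M : Fin n → Fin n → ℤ[ω]) → IsLinear (M ⊙_)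
  ⊙-linear {n} M = record
    { cong   = λ v≈w u → sum-cong-≋ (λ k → *-congˡ {ι (M u k)} (v≈w k))
    ; homo-+ = λ v w u → trans (sum-cong-≋ (λ k → distribˡ (ι (M u k)) (v k) (w k)))
                               (∑-distrib-+ (λ k → ι (M u k) * v k) (λ k → ι (M u k) * w k))
    ; homo-* = λ a v u → trans (sum-cong-≋ (λ k → swap (ι (M u k)) a (v k)))
                               (sym (*-distribˡ-sum a (λ k → ι (M u k) * v k)))
    }
    where
    swap : ∀ x y z → x * (y * z) ≈ y * (x * z)
    swap x y z = trans (sym (*-assoc x y z)) (trans (*-congʳ (*-comm x y)) (*-assoc y x z))

  -- The rows of d M - e I are relations satisfied by `v`, so the point from `ℤ[ω]-point` satisfies
  -- them too. The pair `d`, `e` encodes an eigenvalue e/d in ℚ(ω) without division.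
  ℤ[ω]-eigenvector : ∀ {n} (M : Fin n → Fin n → ℤ[ω]) d e (v : Vector Carrier n) → NonZero v →
    (∀ u → ι d * (M ⊙ v) u ≈ ι e * v u) →
    ¬ ¬ (Σ[ z ∈ Vector ℤ[ω] n ] (∃[ k ] z k ≢ 𝔼.0#) ×
         (∀ u → d 𝔼.* ∑𝔼.sum (λ w → M u w 𝔼.* z w) ≡ e 𝔼.* z u))
  ℤ[ω]-eigenvector {n} M d e v v≢0 eq = ¬¬-map
    (λ (z , z≢0 , rel) → z , z≢0 , λ u → RingProperties.x∙y⁻¹≈ε⇒x≈y 𝔼.ring _ _
      (≡.trans (≡.sym (∑𝔼.sum-sub-δ d e (M u) z u)) (rel (λ w → d 𝔼.* M u w 𝔼.- e 𝔼.* ∑𝔼.δ u w) (relation u))))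
    (ℤ[ω]-point v v≢0)
    where
    ι-δ : ∀ {n} (u w : Fin n) → ι (∑𝔼.δ u w) ≈ δ u w
    ι-δ zero    zero    = ι-1
    ι-δ zero    (suc w) = ι-0
    ι-δ (suc u) zero    = ι-0
    ι-δ (suc u) (suc w) = ι-δ u w
    relation : ∀ u → ∑[ w < n ] (ι (d 𝔼.* M u w 𝔼.- e 𝔼.* ∑𝔼.δ u w) * v w) ≈ 0#
    relation u = begin
      ∑[ w < n ] (ι (d 𝔼.* M u w 𝔼.- e 𝔼.* ∑𝔼.δ u w) * v w)
        ≈⟨ sum-cong-≋ (λ w → *-congʳ {v w} (ι-coefficient w)) ⟩
      ∑[ w < n ] ((ι d * ι (M u w) - ι e * δ u w) * v w)
        ≈⟨ sum-sub-δ (ι d) (ι e) (ι ∘ M u) v u ⟩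
      ι d * (M ⊙ v) u - ι e * v u
        ≈⟨ +-congʳ (eq u) ⟩
      ι e * v u - ι e * v u
        ≈⟨ -‿inverseʳ _ ⟩
      0# ∎
      where
      ι-coefficient : ∀ w → ι (d 𝔼.* M u w 𝔼.- e 𝔼.* ∑𝔼.δ u w) ≈ ι d * ι (M u w) - ι e * δ u w
      ι-coefficient w = trans (ι-+ (d 𝔼.* M u w) (𝔼.- (e 𝔼.* ∑𝔼.δ u w)))
        (+-cong (ι-* d (M u w)) (trans (ι-neg (e 𝔼.* ∑𝔼.δ u w)) (-‿cong (trans (ι-* e (∑𝔼.δ u w)) (*-congˡ (ι-δ u w))))))

  -- Removing double negations by finiteness.

  ι-apart : ∀ {x y} → x ≢ y → ι x # ι y
  ι-apart {x} {y} x≢y =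
    let z , eq = inverse (ι-# (x 𝔼.- y) (x≢y ∘ RingProperties.x∙y⁻¹≈ε⇒x≈y 𝔼.ring x y))
        inv : (ι x - ι y) * z ≈ 1#
        inv = trans (*-congʳ (sym (trans (ι-+ x (𝔼.- y)) (+-congˡ (ι-neg y))))) eq
    in invertible⇒# (z , trans (*-comm _ _) inv , inv)

  -- Membership in a finite set of Eisenstein integers is ¬¬-stable:
  -- cotransitivity of apartness rules out all candidates but one.
  identify : ∀ x e (es : List ℤ[ω]) → ¬ ¬ (∃[ y ] x ≈ ι y × y ∈ e ∷ es) → ∃[ y ] x ≈ ι y
  identify x e []        x∈ = e , proj₁ (tight x (ι e)) λ x#e → x∈ λ
    { (y , x≈y , here y≡e) → proj₂ (tight x (ι e)) (≡.subst (λ y → x ≈ ι y) y≡e x≈y) x#e }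
  identify x e (e′ ∷ es) x∈ = drop-one (e ≟ e′)
    where
    x≈ι : ℤ[ω] → Set _
    x≈ι y = x ≈ ι y

    drop-first : ¬ x ≈ ι e → (∃[ y ] x≈ι y × y ∈ e ∷ e′ ∷ es) → ∃[ y ] x≈ι y × y ∈ e′ ∷ es
    drop-first x≉e (y , x≈y , here y≡e)  = contradiction (≡.subst x≈ι y≡e x≈y) x≉e
    drop-first x≉e (y , x≈y , there y∈) = y , x≈y , y∈

    drop-second : (x ≈ ι e′ → x ≈ ι e) → (∃[ y ] x≈ι y × y ∈ e ∷ e′ ∷ es) → ∃[ y ] x≈ι y × y ∈ e ∷ es
    drop-second e′⇒e (y , x≈y , here y≡e)          = y , x≈y , here y≡e
    drop-second e′⇒e (y , x≈y , there (here y≡e′)) = e , e′⇒e (≡.subst x≈ι y≡e′ x≈y) , here ≡.refl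
    drop-second e′⇒e (y , x≈y , there (there y∈))  = y , x≈y , there y∈

    drop-apart : ι e # x ⊎ x # ι e′ → ∃[ y ] x≈ι y
    drop-apart (inj₁ e#x)  = identify x e′ es
      (¬¬-map (drop-first (λ x≈e → proj₂ (tight x (ι e)) x≈e (#-sym e#x))) x∈)
    drop-apart (inj₂ x#e′) = identify x e es
      (¬¬-map (drop-second (λ x≈e′ → contradiction x#e′ (proj₂ (tight x (ι e′)) x≈e′))) x∈)

    drop-one : Dec (e ≡ e′) → ∃[ y ] x≈ι y
    drop-one (yes e≡e′) = identify x e es (¬¬-map (drop-second (≡.subst x≈ι (≡.sym e≡e′))) x∈)
    drop-one (no  e≢e′) = drop-apart (#-cotrans (ι-apart e≢e′) x)

  -- A bound on the norm bounds both coordinates, so only the finitely many points of a box remain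
  -- and `identify` applies.
  bounded-stable : ∀ x N → ¬ ¬ (∃[ y ] x ≈ ι y × norm y ℤ.≤ N) → ∃[ y ] x ≈ ι y
  -- `0#` is there to supply the head that `identify` asks for; `y` is found in `box`.
  bounded-stable x N x∈ = identify x 𝔼.0# box (¬¬-map (λ { (y , x≈y , y≤N) → y , x≈y , there (y∈box y y≤N) }) x∈)
    where
    B : ℕ
    B = 4 ℕ.* ℤ.∣ N ∣
    interval : List ℤ
    -- From -B to B: `-[1+ n ]` is -(n + 1), so the negative half stops one index earlier.
    interval = map +_ (upTo (suc B)) ++ map -[1+_] (upTo B)
    box : List ℤ[ω]
    box = cartesianProductWith _+ω_ interval interval
    ∈interval : ∀ a → ℤ.∣ a ∣ ℕ.≤ B → a ∈ interval
    ∈interval (+ n)    n≤B = ∈-++⁺ˡ (∈-map⁺ +_ (∈-upTo⁺ (ℕ.s≤s n≤B)))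
    ∈interval -[1+ n ] n<B = ∈-++⁺ʳ (map +_ (upTo (suc B))) (∈-map⁺ -[1+_] (∈-upTo⁺ n<B))
    y∈box : ∀ y → norm y ℤ.≤ N → y ∈ box
    y∈box (a +ω b) y≤N = ∈-cartesianProductWith⁺ _+ω_
      (∈interval a (ℕ.≤-trans (∣a∣≤4norm a b) 4norm≤B))
      (∈interval b (ℕ.≤-trans (∣a∣≤4norm b a) (ℕ.≤-trans (ℕ.≤-reflexive (≡.cong (λ m → 4 ℕ.* ℤ.∣ m ∣) (norm-swap b a))) 4norm≤B)))
      where
      4norm≤B : 4 ℕ.* ℤ.∣ norm (a +ω b) ∣ ℕ.≤ B
      4norm≤B = ℕ.*-monoʳ-≤ 4 (∣-mono (0≤norm (a +ω b)) y≤N)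
        where
        ∣-mono : ∀ {i j} → + 0 ℤ.≤ i → i ℤ.≤ j → ℤ.∣ i ∣ ℕ.≤ ℤ.∣ j ∣
        ∣-mono (ℤ.+≤+ _) (ℤ.+≤+ i≤j) = i≤j

-- Spectra of normal mixed graphs

-- The primitive sixth roots of unity, -ω² and -ω.
ω₆ ω̄₆ : ℤ[ω]
ω₆ = + 1 +ω + 1
ω̄₆ = + 0 +ω -[1+ 0 ]

indicator : Bool → ℤ[ω]
indicator b = if b then 𝔼.1# else 𝔼.0#

module NormalGraph {c ℓ₁ ℓ₂ a ℓ e} (K : ComplexField c ℓ₁ ℓ₂) (G : MixedGraph a ℓ e) where
  open LinearAlgebra K
  open MixedGraph G using (hasEdge) renaming (order to n)
  open Sum semiring using (sum; sum-cong-≋; ∑-comm; ∑-distrib-+; ∑-permute; *-distribˡ-sum; *-distribʳ-sum)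
  open ≈-Reasoning setoid

  A Aᵀ H : Fin n → Fin n → ℤ[ω]
  A u w = indicator (hasEdge u w)
  Aᵀ u w = A w u
  H u w = ω₆ 𝔼.* A u w 𝔼.+ ω̄₆ 𝔼.* A w u

  ι-A : ∀ u w → ι (A u w) ≈ 𝒜 K G u w
  ι-A u w with hasEdge u w
  ... | true  = ι-1
  ... | false = ι-0

  ι-H : ∀ u w → ι (H u w) ≈ ℋ K G u w
  ι-H u w with hasEdge u w | hasEdge w u
  ... | true  | true  = ι-1
  ... | true  | false = begin
    fromℤ (+ 1) + fromℤ (+ 1) * ((- 1# + i * √3) * ½)
      ≈⟨ +-cong (+-identityʳ 1#) (trans (*-congʳ (+-identityʳ 1#)) (*-identityˡ _)) ⟩
    1# + (- 1# + i * √3) * ½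
      ≈⟨ +-congʳ ½*2≈1 ⟨
    ½ * fromℤ (+ 2) + (- 1# + i * √3) * ½
      ≈⟨ +-congʳ (*-congˡ (+-congˡ (+-identityʳ 1#))) ⟩
    ½ * (1# + 1#) + (- 1# + i * √3) * ½
      ≈⟨ solve 3 (λ h o t → h :* (o :+ o) :+ (:- o :+ t) :* h := (o :+ t) :* h) refl ½ 1# (i * √3) ⟩
    (1# + i * √3) * ½ ∎
    where open ℤ-Solver
  ... | false | true  = begin
    0# + - (1# + 0#) * ((- 1# + i * √3) * ½)
      ≈⟨ trans (+-identityˡ _) (*-congʳ (-‿cong (+-identityʳ 1#))) ⟩
    - 1# * ((- 1# + i * √3) * ½)
      ≈⟨ solve 3 (λ h o t → (:- o) :* ((:- o :+ t) :* h) := o :* ((o :- t) :* h)) refl ½ 1# (i * √3) ⟩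
    1# * ((1# - i * √3) * ½)
      ≈⟨ *-identityˡ _ ⟩
    (1# - i * √3) * ½ ∎
    where open ℤ-Solver
  ... | false | false = ι-0

  norm-A≤1 : ∀ u w → norm (A u w) ℤ.≤ + 1
  norm-A≤1 u w with hasEdge u w
  ... | true  = ℤₚ.≤-refl
  ... | false = ℤ.+≤+ ℕ.z≤n

  norm-H≤1 : ∀ u w → norm (H u w) ℤ.≤ + 1
  norm-H≤1 u w with hasEdge u w | hasEdge w u
  ... | true  | true  = ℤₚ.≤-refl
  ... | true  | false = ℤₚ.≤-refl
  ... | false | true  = ℤₚ.≤-refl
  ... | false | false = ℤ.+≤+ ℕ.z≤n

  H-hermitian : ∀ u w → H u w ≡ conj (H w u)
  H-hermitian u w with hasEdge u w | hasEdge w u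
  ... | true  | true  = ≡.refl
  ... | true  | false = ≡.refl
  ... | false | true  = ≡.refl
  ... | false | false = ≡.refl

  infix 4 _∈Eigenspace_,_
  _∈Eigenspace_,_ : Vector Carrier n → (Fin n → Fin n → ℤ[ω]) → Carrier → Set _
  v ∈Eigenspace M , μ = ∀ u → (M ⊙ v) u ≈ μ * v u

  eigenspace-subspace : ∀ M μ → IsSubspace (_∈Eigenspace M , μ)
  eigenspace-subspace M μ = record
    { +-closed = λ {v} {w} Mv Mw u → trans (homo-+ v w u) (trans (+-cong (Mv u) (Mw u)) (sym (distribˡ _ _ _)))
    ; *-closed = λ a {v} Mv u → trans (homo-* a v u) (trans (*-congˡ (Mv u))
        (trans (sym (*-assoc _ _ _)) (trans (*-congʳ (*-comm a μ)) (*-assoc _ _ _))))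
    }
    where open IsLinear (⊙-linear M)

  eigenvalue-unique : ∀ M {μ μ′ v} → NonZero v → v ∈Eigenspace M , μ → v ∈Eigenspace M , μ′ → μ ≈ μ′
  eigenvalue-unique M (k , vₖ#0) Mv Mv′ = *-cancel-# vₖ#0 (trans (sym (Mv k)) (Mv′ k))

  Commute : (M N : Fin n → Fin n → ℤ[ω]) → Set _
  Commute M N = ∀ v u → (M ⊙ N ⊙ v) u ≈ (N ⊙ M ⊙ v) u

  -- Makes eigenspaces of `M` invariant under `N`, so that an eigenvector of `N` can be sought
  -- inside them.
  commute-closed : ∀ M N {μ v} → Commute M N → v ∈Eigenspace M , μ → N ⊙ v ∈Eigenspace M , μ
  commute-closed M N {μ} {v} comm Mv u = trans (comm v u) (trans (cong Mv u) (homo-* μ v u))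
    where open IsLinear (⊙-linear N)

  ι-sum : ∀ {m} (f : Vector ℤ[ω] m) → ι (∑𝔼.sum f) ≈ ∑[ k < m ] ι (f k)
  ι-sum {zero}  f = ι-0
  ι-sum {suc m} f = trans (ι-+ (f Fin.zero) (∑𝔼.sum (f ∘ Fin.suc))) (+-congˡ (ι-sum (f ∘ Fin.suc)))

  ⊙-⊙ : ∀ M N v u → (M ⊙ N ⊙ v) u ≈ ∑[ w < n ] (ι (∑𝔼.sum (λ x → M u x 𝔼.* N x w)) * v w)
  ⊙-⊙ M N v u = begin
    ∑[ x < n ] (ι (M u x) * (∑[ w < n ] (ι (N x w) * v w)))
      ≈⟨ sum-cong-≋ (λ x → *-distribˡ-sum (ι (M u x)) (λ w → ι (N x w) * v w)) ⟩
    ∑[ x < n ] ∑[ w < n ] (ι (M u x) * (ι (N x w) * v w))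
      ≈⟨ ∑-comm (λ x w → ι (M u x) * (ι (N x w) * v w)) ⟩
    ∑[ w < n ] ∑[ x < n ] (ι (M u x) * (ι (N x w) * v w))
      ≈⟨ sum-cong-≋ column ⟩
    ∑[ w < n ] (ι (∑𝔼.sum (λ x → M u x 𝔼.* N x w)) * v w) ∎
    where
    column : ∀ w → ∑[ x < n ] (ι (M u x) * (ι (N x w) * v w)) ≈ ι (∑𝔼.sum (λ x → M u x 𝔼.* N x w)) * v w
    column w = begin
      ∑[ x < n ] (ι (M u x) * (ι (N x w) * v w))  ≈⟨ sum-cong-≋ entry ⟩
      ∑[ x < n ] (ι (M u x 𝔼.* N x w) * v w)      ≈⟨ *-distribʳ-sum (v w) (λ x → ι (M u x 𝔼.* N x w)) ⟨
      (∑[ x < n ] ι (M u x 𝔼.* N x w)) * v w      ≈⟨ *-congʳ (ι-sum (λ x → M u x 𝔼.* N x w)) ⟨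
      ι (∑𝔼.sum (λ x → M u x 𝔼.* N x w)) * v w    ∎
      where
      entry : ∀ x → ι (M u x) * (ι (N x w) * v w) ≈ ι (M u x 𝔼.* N x w) * v w
      entry x = trans (sym (*-assoc _ _ _)) (*-congʳ (sym (ι-* (M u x) (N x w))))

  -- Reduces commutation over the field to an entrywise identity in ℤ[ω].
  products⇒commute : ∀ M N → (∀ u w → ∑𝔼.sum (λ x → M u x 𝔼.* N x w) ≡ ∑𝔼.sum (λ x → N u x 𝔼.* M x w)) → Commute M N
  products⇒commute M N MN≡NM v u = trans (⊙-⊙ M N v u)
    (trans (sum-cong-≋ (λ w → *-congʳ {v w} (reflexive (≡.cong ι (MN≡NM u w))))) (sym (⊙-⊙ N M v u)))

  H-⊙ : ∀ v u → (H ⊙ v) u ≈ ι ω₆ * (A ⊙ v) u + ι ω̄₆ * (Aᵀ ⊙ v) u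
  H-⊙ v u = begin
    ∑[ w < n ] (ι (H u w) * v w)
      ≈⟨ sum-cong-≋ entry ⟩
    ∑[ w < n ] (ι ω₆ * (ι (A u w) * v w) + ι ω̄₆ * (ι (A w u) * v w))
      ≈⟨ ∑-distrib-+ (λ w → ι ω₆ * (ι (A u w) * v w)) (λ w → ι ω̄₆ * (ι (A w u) * v w)) ⟩
    (∑[ w < n ] (ι ω₆ * (ι (A u w) * v w))) + (∑[ w < n ] (ι ω̄₆ * (ι (A w u) * v w)))
      ≈⟨ +-cong (*-distribˡ-sum (ι ω₆) (λ w → ι (A u w) * v w)) (*-distribˡ-sum (ι ω̄₆) (λ w → ι (A w u) * v w)) ⟨
    ι ω₆ * (A ⊙ v) u + ι ω̄₆ * (Aᵀ ⊙ v) u ∎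
    where
    entry : ∀ w → ι (H u w) * v w ≈ ι ω₆ * (ι (A u w) * v w) + ι ω̄₆ * (ι (A w u) * v w)
    entry w = begin
      ι (ω₆ 𝔼.* A u w 𝔼.+ ω̄₆ 𝔼.* A w u) * v w
        ≈⟨ *-congʳ (trans (ι-+ (ω₆ 𝔼.* A u w) (ω̄₆ 𝔼.* A w u)) (+-cong (ι-* ω₆ (A u w)) (ι-* ω̄₆ (A w u)))) ⟩
      (ι ω₆ * ι (A u w) + ι ω̄₆ * ι (A w u)) * v w
        ≈⟨ trans (distribʳ _ _ _) (+-cong (*-assoc _ _ _) (*-assoc _ _ _)) ⟩
      ι ω₆ * (ι (A u w) * v w) + ι ω̄₆ * (ι (A w u) * v w) ∎

  H-eigenspace : ∀ {λ₁ λ₂ v} → v ∈Eigenspace A , λ₁ → v ∈Eigenspace Aᵀ , λ₂ →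
                 v ∈Eigenspace H , (ι ω₆ * λ₁ + ι ω̄₆ * λ₂)
  H-eigenspace {λ₁} {λ₂} {v} Av Aᵀv u = begin
    (H ⊙ v) u                                      ≈⟨ H-⊙ v u ⟩
    ι ω₆ * (A ⊙ v) u + ι ω̄₆ * (Aᵀ ⊙ v) u          ≈⟨ +-cong (*-congˡ (Av u)) (*-congˡ (Aᵀv u)) ⟩
    ι ω₆ * (λ₁ * v u) + ι ω̄₆ * (λ₂ * v u)          ≈⟨ trans (distribʳ _ _ _) (+-cong (*-assoc _ _ _) (*-assoc _ _ _)) ⟨
    (ι ω₆ * λ₁ + ι ω̄₆ * λ₂) * v u                  ∎

  H-commute : ∀ N → Commute A N → Commute Aᵀ N → Commute H N
  H-commute N AN AᵀN v u = begin
    (H ⊙ N ⊙ v) u                                        ≈⟨ H-⊙ (N ⊙ v) u ⟩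
    ι ω₆ * (A ⊙ N ⊙ v) u + ι ω̄₆ * (Aᵀ ⊙ N ⊙ v) u        ≈⟨ +-cong (*-congˡ (AN v u)) (*-congˡ (AᵀN v u)) ⟩
    ι ω₆ * (N ⊙ A ⊙ v) u + ι ω̄₆ * (N ⊙ Aᵀ ⊙ v) u        ≈⟨ +-cong (homo-* (ι ω₆) (A ⊙ v) u) (homo-* (ι ω̄₆) (Aᵀ ⊙ v) u) ⟨
    (N ⊙ (λ w → ι ω₆ * (A ⊙ v) w)) u + (N ⊙ (λ w → ι ω̄₆ * (Aᵀ ⊙ v) w)) u
      ≈⟨ homo-+ (λ w → ι ω₆ * (A ⊙ v) w) (λ w → ι ω̄₆ * (Aᵀ ⊙ v) w) u ⟨
    (N ⊙ (λ w → ι ω₆ * (A ⊙ v) w + ι ω̄₆ * (Aᵀ ⊙ v) w)) u  ≈⟨ cong (λ w → H-⊙ v w) u ⟨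
    (N ⊙ H ⊙ v) u ∎
    where open IsLinear (⊙-linear N)

  toEigenvalue : ∀ M {N : Matrix n} {μ v} → (∀ u w → ι (M u w) ≈ N u w) →
                 NonZero v → v ∈Eigenspace M , μ → IsEigenvalue N μ
  toEigenvalue M {v = v} ιM≈N v≢0 Mv =
    v , v≢0 , λ u → trans (sum-cong-≋ (λ w → *-congʳ {v w} (sym (ιM≈N u w)))) (Mv u)

  -- The field has no absolute value, so the estimate is made on an eigenvector over ℤ[ω] for the
  -- same eigenvalue.
  norm-eigenvalue-bound : ∀ M → (∀ u w → norm (M u w) ℤ.≤ + 1) → ∀ {μ v} m → NonZero v →
    v ∈Eigenspace M , μ → μ ≈ ι m → ¬ ¬ (norm m ℤ.≤ norm-bound n)
  norm-eigenvalue-bound M M≤1 {μ} {v} m v≢0 Mv μ≈m = ¬¬-map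
    (λ (z , z≢0 , Mz) → norm-eigenvalue M M≤1 m z z≢0 (λ u → ≡.trans (≡.sym (𝔼.*-identityˡ _)) (Mz u)))
    (ℤ[ω]-eigenvector M 𝔼.1# m v v≢0 (λ u → trans (*-congʳ ι-1) (trans (*-identityˡ _) (trans (Mv u) (*-congʳ μ≈m)))))

  -- The spectral argument uses just these two facts about the Cayley graph: its adjacency matrix is
  -- normal, and a relabelling of the vertices reverses all edges.
  module _ (AAᵀ≡AᵀA : ∀ u w → ∑𝔼.sum (λ x → A u x 𝔼.* A w x) ≡ ∑𝔼.sum (λ x → A x u 𝔼.* A x w))
           (π : Permutation n n) (A-π : ∀ u w → A (π ⟨$⟩ʳ w) (π ⟨$⟩ʳ u) ≡ A u w) where

    A-Aᵀ-commute : Commute A Aᵀ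
    A-Aᵀ-commute = products⇒commute A Aᵀ AAᵀ≡AᵀA

    -- Relabelling the vertices moves eigenvectors between `A` and `Aᵀ`, so both have the same
    -- eigenvalues.
    rearranged : ∀ M N {μ v} → (∀ u w → N (π ⟨$⟩ʳ u) (π ⟨$⟩ʳ w) ≡ M u w) →
      v ∈Eigenspace N , μ → v ∘ (π ⟨$⟩ʳ_) ∈Eigenspace M , μ
    rearranged M N {μ} {v} N-π Nv u = begin
      ∑[ w < n ] (ι (M u w) * v (π ⟨$⟩ʳ w))
        ≈⟨ sum-cong-≋ (λ w → *-congʳ {v (π ⟨$⟩ʳ w)} (reflexive (≡.cong ι (≡.sym (N-π u w))))) ⟩
      ∑[ w < n ] (ι (N (π ⟨$⟩ʳ u) (π ⟨$⟩ʳ w)) * v (π ⟨$⟩ʳ w))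
        ≈⟨ ∑-permute (λ w → ι (N (π ⟨$⟩ʳ u) w) * v w) π ⟨
      (N ⊙ v) (π ⟨$⟩ʳ u)
        ≈⟨ Nv (π ⟨$⟩ʳ u) ⟩
      μ * v (π ⟨$⟩ʳ u) ∎

    rearranged-nonzero : ∀ {v} → NonZero v → NonZero (v ∘ (π ⟨$⟩ʳ_))
    rearranged-nonzero {v} (k , vₖ#0) = π ⟨$⟩ˡ k , ≡.subst (λ k → v k # 0#) (≡.sym (Permutation.inverseʳ π)) vₖ#0

    -- First find an eigenvector of `A` inside the eigenspace of `M`, then one of `Aᵀ` inside the
    -- intersection of the two eigenspaces, which `Aᵀ` preserves as it commutes with `M` and `A`.
    common-eigenvector : ∀ M {μ v} → Commute M A → Commute M Aᵀ → NonZero v → v ∈Eigenspace M , μ →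
      ¬ ¬ (∃[ λ₁ ] ∃[ λ₂ ] ∃[ w ] NonZero w × w ∈Eigenspace M , μ × w ∈Eigenspace A , λ₁ × w ∈Eigenspace Aᵀ , λ₂)
    common-eigenvector M {μ} MA MAᵀ v≢0 Mv ¬eig =
      EA.eigenvector (eigenspace-subspace M μ) (commute-closed M A MA) Mv v≢0 λ (λ₁ , w , Mw , w≢0 , Aw) →
      EAᵀ.eigenvector {P = λ v → (v ∈Eigenspace M , μ) × (v ∈Eigenspace A , λ₁)}
        (record
          { +-closed = λ (Mv , Av) (Mw , Aw) → +-closed (eigenspace-subspace M μ) Mv Mw , +-closed (eigenspace-subspace A λ₁) Av Aw
          ; *-closed = λ a (Mv , Av) → *-closed (eigenspace-subspace M μ) a Mv , *-closed (eigenspace-subspace A λ₁) a Av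
          })
        (λ (Mv , Av) → commute-closed M Aᵀ MAᵀ Mv , commute-closed A Aᵀ A-Aᵀ-commute Av)
        (Mw , Aw) w≢0 λ (λ₂ , w , (Mw , Aw) , w≢0 , Aᵀw) →
      ¬eig (λ₁ , λ₂ , w , w≢0 , Mw , Aw , Aᵀw)
      where
      open IsSubspace
      module EA = Eigenvectors (A ⊙_) (⊙-linear A)
      module EAᵀ = Eigenvectors (Aᵀ ⊙_) (⊙-linear Aᵀ)

    eisenstein⇒HS : EisensteinIntegral K G → HSIntegral K G
    eisenstein⇒HS eisenstein μ (v , v≢0 , ℋv) = real m μ≈m m-real
      where
      Hv : v ∈Eigenspace H , μ
      Hv u = trans (sum-cong-≋ (λ w → *-congʳ {v w} (ι-H u w))) (ℋv u)

      μ∈ℤ[ω] : ¬ ¬ (∃[ m ] μ ≈ ι m)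
      μ∈ℤ[ω] ¬m = common-eigenvector H (H-commute A (λ _ _ → refl) (λ v u → sym (A-Aᵀ-commute v u)))
        (H-commute Aᵀ A-Aᵀ-commute (λ _ _ → refl)) v≢0 Hv λ (λ₁ , λ₂ , w , w≢0 , Hw , Aw , Aᵀw) →
        let isEisenstein = λ {λ′} {w} (w≢0 : NonZero w) (Aw : w ∈Eigenspace A , λ′) → eisenstein λ′ (toEigenvalue A ι-A w≢0 Aw)
            x , x′ , λ₁≈x = isEisenstein w≢0 Aw
            -- After relabelling, λ₂ is an eigenvalue of `A` as well, so the hypothesis covers it.
            y , y′ , λ₂≈y = isEisenstein (rearranged-nonzero w≢0) (rearranged A Aᵀ A-π Aᵀw)
        in ¬m (ω₆ 𝔼.* (x +ω x′) 𝔼.+ ω̄₆ 𝔼.* (y +ω y′) , (begin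
          μ ≈⟨ eigenvalue-unique H w≢0 Hw (H-eigenspace Aw Aᵀw) ⟩
          ι ω₆ * λ₁ + ι ω̄₆ * λ₂  ≈⟨ +-cong (*-congˡ λ₁≈x) (*-congˡ λ₂≈y) ⟩
          ι ω₆ * ι (x +ω x′) + ι ω̄₆ * ι (y +ω y′)  ≈⟨ +-cong (ι-* ω₆ (x +ω x′)) (ι-* ω̄₆ (y +ω y′)) ⟨
          ι (ω₆ 𝔼.* (x +ω x′)) + ι (ω̄₆ 𝔼.* (y +ω y′))  ≈⟨ ι-+ (ω₆ 𝔼.* (x +ω x′)) (ω̄₆ 𝔼.* (y +ω y′)) ⟨
          ι (ω₆ 𝔼.* (x +ω x′) 𝔼.+ ω̄₆ 𝔼.* (y +ω y′)) ∎))

      μ-bounded : ∃[ m ] μ ≈ ι m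
      -- The Eisenstein integer is known only under a double negation; the norm bound for `H` makes
      -- it explicit.
      μ-bounded = bounded-stable μ (norm-bound n) λ ¬m → μ∈ℤ[ω] λ (m , μ≈m) →
        norm-eigenvalue-bound H norm-H≤1 m v≢0 Hv μ≈m λ m≤ → ¬m (m , μ≈m , m≤)

      m : ℤ[ω]
      m = proj₁ μ-bounded

      μ≈m : μ ≈ ι m
      μ≈m = proj₂ μ-bounded

      m-real : conj m ≡ m
      -- Equality in ℤ[ω] is decidable, so a doubly negated eigenvector suffices.
      m-real = decidable-stable (conj m ≟ m) (¬¬-map
        (λ (z , z≢0 , Hz) → hermitian-eigenvalue H H-hermitian m z z≢0 (λ u → ≡.trans (≡.sym (𝔼.*-identityˡ _)) (Hz u)))
        (ℤ[ω]-eigenvector H 𝔼.1# m v v≢0 (λ u → trans (*-congʳ ι-1) (trans (*-identityˡ _) (trans (Hv u) (*-congʳ μ≈m))))))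

      real : ∀ m → μ ≈ ι m → conj m ≡ m → IsInteger μ
      -- Conjugation negates the coefficient of ω, so a fixed element has coefficient 0.
      real (a +ω + zero)   μ≈m _ = a , trans μ≈m (ι-fromℤ a)
      real (a +ω + suc _)  μ≈m ()
      real (a +ω -[1+ _ ]) μ≈m ()

    HS⇒eisenstein : HSIntegral K G → EisensteinIntegral K G
    HS⇒eisenstein hs μ (v , v≢0 , 𝒜v) = components (bounded-stable μ (norm-bound n) λ ¬q →
      common-eigenvector A (λ _ _ → refl) A-Aᵀ-commute v≢0 Av λ (λ₁ , λ₂ , w , w≢0 , Aw , Aw′ , Aᵀw) →
      let m₁ , eq₁ = hs _ (toEigenvalue H ι-H w≢0 (H-eigenspace Aw Aᵀw))
          -- Relabelling `w` exchanges its eigenvalues under `A` and `Aᵀ`, which yields the second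
          -- eigenvalue ω₆ λ₂ + ω̄₆ μ of `H`.
          m₂ , eq₂ = hs _ (toEigenvalue H ι-H (rearranged-nonzero w≢0)
                       (H-eigenspace (rearranged A Aᵀ A-π Aᵀw) (rearranged Aᵀ A (λ u w → A-π w u) Aw)))
      in integral m₁ (m₂ ℤ.- m₁) (√-3μ m₁ m₂ eq₁ eq₂) λ (q , μ≈q) →
         norm-eigenvalue-bound A norm-A≤1 q v≢0 Av μ≈q λ q≤ → ¬q (q , μ≈q , q≤))
      where
      Av : v ∈Eigenspace A , μ
      Av u = trans (sum-cong-≋ (λ w → *-congʳ {v w} (ι-A u w))) (𝒜v u)

      components : ∃[ q ] μ ≈ ι q → IsEisensteinInteger μ
      components (a +ω b , μ≈q) = a , b , μ≈q

      -- Eliminates λ₂, using ω₆² - ω̄₆² = √-3. The right side is arranged so that `√-3` divides it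
      -- exactly when 3 divides m₂ - m₁.
      √-3μ : ∀ {λ₂} m₁ m₂ → ι ω₆ * μ + ι ω̄₆ * λ₂ ≈ fromℤ m₁ → ι ω₆ * λ₂ + ι ω̄₆ * μ ≈ fromℤ m₂ →
             ι √-3 * μ ≈ ι (√-3 𝔼.* (m₁ +ω + 0) 𝔼.+ (m₂ ℤ.- m₁ +ω + 0) 𝔼.* ω)
      √-3μ {λ₂} m₁ m₂ eq₁ eq₂ = begin
        ι √-3 * μ
          ≈⟨ solve 2 (λ x y → con √-3 :* x := con ω₆ :* (con ω₆ :* x :+ con ω̄₆ :* y) :- con ω̄₆ :* (con ω₆ :* y :+ con ω̄₆ :* x)) refl μ λ₂ ⟩
        ι ω₆ * (ι ω₆ * μ + ι ω̄₆ * λ₂) - ι ω̄₆ * (ι ω₆ * λ₂ + ι ω̄₆ * μ)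
          ≈⟨ +-cong (*-congˡ (trans eq₁ (sym (ι-fromℤ m₁)))) (-‿cong (*-congˡ (trans eq₂ (sym (ι-fromℤ m₂))))) ⟩
        ι ω₆ * ι (m₁ +ω + 0) - ι ω̄₆ * ι (m₂ +ω + 0)
          ≈⟨ solve 2 (λ x y → con ω₆ :* x :- con ω̄₆ :* y := con √-3 :* x :+ (y :- x) :* con ω) refl (ι (m₁ +ω + 0)) (ι (m₂ +ω + 0)) ⟩
        ι √-3 * ι (m₁ +ω + 0) + (ι (m₂ +ω + 0) - ι (m₁ +ω + 0)) * ι ω
          ≈⟨ +-cong (ι-* √-3 (m₁ +ω + 0)) (trans (ι-* (m₂ ℤ.- m₁ +ω + 0) ω)
               (*-congʳ (trans (ι-+ (m₂ +ω + 0) (ℤ.- m₁ +ω + 0)) (+-congˡ (ι-neg (m₁ +ω + 0)))))) ⟨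
        ι (√-3 𝔼.* (m₁ +ω + 0)) + ι ((m₂ ℤ.- m₁ +ω + 0) 𝔼.* ω)
          ≈⟨ ι-+ (√-3 𝔼.* (m₁ +ω + 0)) ((m₂ ℤ.- m₁ +ω + 0) 𝔼.* ω) ⟨
        ι (√-3 𝔼.* (m₁ +ω + 0) 𝔼.+ (m₂ ℤ.- m₁ +ω + 0) 𝔼.* ω) ∎
        where open K-Solver

      -- If 3 divides `m`, divide by `√-3`. Otherwise the descent excludes a nonzero eigenvector
      -- over ℤ[ω], although one exists up to double negation.
      integral : ∀ m₁ m → ι √-3 * μ ≈ ι (√-3 𝔼.* (m₁ +ω + 0) 𝔼.+ (m +ω + 0) 𝔼.* ω) → ¬ ¬ (∃[ q ] μ ≈ ι q)
      integral m₁ m eq = by-residue (m %ℕ 3) (n%ℕd<d m 3) (a≡a%ℕn+[a/ℕn]*n m 3)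
        where
        k : ℤ
        k = m /ℕ 3

        coprime : ∀ c k → c ℤ.* m ≡ + 1 ℤ.+ + 3 ℤ.* k → ¬ ¬ (∃[ q ] μ ≈ ι q)
        coprime c k cm≡1+3k _ = ℤ[ω]-eigenvector A √-3 (√-3 𝔼.* (m₁ +ω + 0) 𝔼.+ (m +ω + 0) 𝔼.* ω) v v≢0
          (λ u → trans (*-congˡ (Av u)) (trans (sym (*-assoc _ _ _)) (*-congʳ eq)))
          λ (z , (u , zᵤ≢0) , Az) → zᵤ≢0 (√-3-descent A (m₁ +ω + 0) m c k cm≡1+3k z Az u)

        by-residue : ∀ r → r ℕ.< 3 → m ≡ + r ℤ.+ k ℤ.* + 3 → ¬ ¬ (∃[ q ] μ ≈ ι q)
        by-residue 0 _ m≡ ¬q = ¬q (q , *-cancel-# (ι-# √-3 λ ()) (begin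
          μ * ι √-3          ≈⟨ *-comm _ _ ⟩
          ι √-3 * μ          ≈⟨ eq ⟩
          ι (√-3 𝔼.* (m₁ +ω + 0) 𝔼.+ (m +ω + 0) 𝔼.* ω)  ≡⟨ ≡.cong ι factor ⟩
          ι (q 𝔼.* √-3)      ≈⟨ ι-* q √-3 ⟩
          ι q * ι √-3        ∎))
          where
          q : ℤ[ω]
          -- Since 3 = -(√-3)², the quotient of 3kω by `√-3` is -√-3 k ω.
          q = (m₁ +ω + 0) 𝔼.- √-3 𝔼.* (k +ω + 0) 𝔼.* ω
          m≡3k : (m +ω + 0) ≡ (+ 3 +ω + 0) 𝔼.* (k +ω + 0)
          m≡3k = ≡.cong₂ _+ω_ (≡.trans m≡ (re≡ k)) (im≡ k)
            where
            re≡ : ∀ k → + 0 ℤ.+ k ℤ.* + 3 ≡ + 3 ℤ.* k ℤ.- + 0 ℤ.* + 0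
            re≡ = solve-∀
            im≡ : ∀ k → + 0 ≡ + 3 ℤ.* + 0 ℤ.+ + 0 ℤ.* k ℤ.- + 0 ℤ.* + 0
            im≡ = solve-∀
          factor : √-3 𝔼.* (m₁ +ω + 0) 𝔼.+ (m +ω + 0) 𝔼.* ω ≡ q 𝔼.* √-3
          factor = ≡.trans (≡.cong (λ t → √-3 𝔼.* (m₁ +ω + 0) 𝔼.+ t 𝔼.* ω) m≡3k)
            (𝔼-Solver.solve 2 (λ x k → con √-3 :* x :+ con (+ 3 +ω + 0) :* k :* con ω := (x :- con √-3 :* k :* con ω) :* con √-3) ≡.refl (m₁ +ω + 0) (k +ω + 0))
            where open 𝔼-Solver
        -- The multiplier is an inverse of the residue modulo 3: 1 for 1, and in the next case 2 for
        -- 2, as 2 · 2 = 1 + 3.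
        by-residue 1 _ m≡ = coprime (+ 1) k (≡.trans (≡.cong (+ 1 ℤ.*_) m≡) (eq′ k))
          where
          eq′ : ∀ k → + 1 ℤ.* (+ 1 ℤ.+ k ℤ.* + 3) ≡ + 1 ℤ.+ + 3 ℤ.* k
          eq′ = solve-∀
        by-residue 2 _ m≡ = coprime (+ 2) (+ 1 ℤ.+ + 2 ℤ.* k) (≡.trans (≡.cong (+ 2 ℤ.*_) m≡) (eq′ k))
          where
          eq′ : ∀ k → + 2 ℤ.* (+ 2 ℤ.+ k ℤ.* + 3) ≡ + 1 ℤ.+ + 3 ℤ.* (+ 1 ℤ.+ + 2 ℤ.* k)
          eq′ = solve-∀
        by-residue (suc (suc (suc _))) (ℕ.s≤s (ℕ.s≤s (ℕ.s≤s ())))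

-- Normal Cayley graphs

module NormalCayley {a ℓ p} (Γ : FiniteGroup a ℓ) (S : ConnectionSet Γ p) (normal : IsNormal Γ S) where
  open FiniteGroup Γ
  open ConnectionSet S
  open MixedGraph (Cay Γ S) using (vertex; hasEdge)
  open GroupProperties group using (⁻¹-involutive; ⁻¹-anti-homo-∙)
  open ≈-Reasoning setoid

  index : Carrier → Fin order
  index = Inverse.to enumeration

  vertex-index : ∀ x → vertex (index x) ≈ x
  vertex-index = Inverse.strictlyInverseʳ enumeration

  -- If x is h t h⁻¹, its conjugate by g is the conjugate of the same representative t by g h.
  conjugation-invariant : ∀ g {x} → Member x → Member (g ∙ x ∙ g ⁻¹)
  conjugation-invariant g {x} x∈ =
    let t , t∈T , h , x≈ = Equivalence.to (proj₂ normal x) x∈ in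
    Equivalence.from (proj₂ normal _) (t , t∈T , g ∙ h , (begin
      g ∙ x ∙ g ⁻¹                      ≈⟨ ∙-congʳ (∙-congˡ x≈) ⟩
      g ∙ (h ∙ t ∙ h ⁻¹) ∙ g ⁻¹         ≈⟨ ∙-congʳ (trans (sym (assoc _ _ _)) (∙-congʳ (sym (assoc _ _ _)))) ⟩
      g ∙ h ∙ t ∙ h ⁻¹ ∙ g ⁻¹           ≈⟨ assoc _ _ _ ⟩
      g ∙ h ∙ t ∙ (h ⁻¹ ∙ g ⁻¹)         ≈⟨ ∙-congˡ (⁻¹-anti-homo-∙ g h) ⟨
      g ∙ h ∙ t ∙ (g ∙ h) ⁻¹            ∎))

  -- y x is the conjugate of x y by y. Normality is used below in this form.
  ∙-comm-member : ∀ x y → Member (x ∙ y) → Member (y ∙ x)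
  ∙-comm-member x y xy∈ = resp (begin
    y ∙ (x ∙ y) ∙ y ⁻¹   ≈⟨ trans (∙-congʳ (sym (assoc _ _ _))) (assoc _ _ _) ⟩
    y ∙ x ∙ (y ∙ y ⁻¹)   ≈⟨ trans (∙-congˡ (inverseʳ y)) (identityʳ _) ⟩
    y ∙ x                ∎) (conjugation-invariant y xy∈)

  does-cong : ∀ {x y} → x ≈ y → does (member? x) ≡ does (member? y)
  does-cong {x} {y} x≈y = does-⇔ (mk⇔ (resp x≈y) (resp (sym x≈y))) (member? x) (member? y)

  does-∙-comm : ∀ x y → does (member? (x ∙ y)) ≡ does (member? (y ∙ x))
  does-∙-comm x y = does-⇔ (mk⇔ (∙-comm-member x y) (∙-comm-member y x)) (member? (x ∙ y)) (member? (y ∙ x))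

  inverse-permutation : Permutation order order
  inverse-permutation = permutation inv inv inv-inv inv-inv
    where
    inv : Fin order → Fin order
    inv u = index (vertex u ⁻¹)
    inv-inv : ∀ u → inv (inv u) ≡ u
    inv-inv u = ≡.trans (Inverse.to-cong enumeration (trans (⁻¹-cong (vertex-index _)) (⁻¹-involutive _)))
                        (Inverse.strictlyInverseˡ enumeration u)

  -- The edge from w⁻¹ to u⁻¹ tests u⁻¹ w, and the edge from u to w tests w u⁻¹: the same product in
  -- the other order.
  hasEdge-inverse : ∀ u w → hasEdge (inverse-permutation ⟨$⟩ʳ w) (inverse-permutation ⟨$⟩ʳ u) ≡ hasEdge u w
  hasEdge-inverse u w = ≡.trans
    (does-cong (∙-cong (vertex-index _) (trans (⁻¹-cong (vertex-index _)) (⁻¹-involutive _))))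
    (does-∙-comm (vertex u ⁻¹) (vertex w))

  -- Substituting u x⁻¹ w for x matches the terms of (A Aᵀ) u w with those
  -- of (Aᵀ A) u w.
  u·x⁻¹·w : Fin order → Fin order → Fin order → Fin order
  u·x⁻¹·w u w x = index (vertex u ∙ vertex x ⁻¹ ∙ vertex w)

  vertex-u·x⁻¹·w : ∀ u w x → vertex (u·x⁻¹·w u w x) ⁻¹ ≈ vertex w ⁻¹ ∙ (vertex x ∙ vertex u ⁻¹)
  vertex-u·x⁻¹·w u w x = trans (⁻¹-cong (vertex-index _))
    (trans (⁻¹-anti-homo-∙ _ _) (∙-congˡ (trans (⁻¹-anti-homo-∙ _ _) (∙-congʳ (⁻¹-involutive _)))))

  u·x⁻¹·w-permutation : Fin order → Fin order → Permutation order order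
  u·x⁻¹·w-permutation u w = permutation (u·x⁻¹·w u w) (u·x⁻¹·w w u) (inverts u w) (inverts w u)
    where
    inverts : ∀ u w x → u·x⁻¹·w u w (u·x⁻¹·w w u x) ≡ x
    inverts u w x = ≡.trans (Inverse.to-cong enumeration (begin
      g ∙ vertex (u·x⁻¹·w w u x) ⁻¹ ∙ h  ≈⟨ ∙-congʳ (∙-congˡ (vertex-u·x⁻¹·w w u x)) ⟩
      g ∙ (g ⁻¹ ∙ (k ∙ h ⁻¹)) ∙ h        ≈⟨ ∙-congʳ (trans (sym (assoc _ _ _)) (trans (∙-congʳ (inverseʳ g)) (identityˡ _))) ⟩
      k ∙ h ⁻¹ ∙ h                       ≈⟨ trans (assoc _ _ _) (trans (∙-congˡ (inverseˡ h)) (identityʳ k)) ⟩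
      k                                  ∎))
      (Inverse.strictlyInverseˡ enumeration x)
      where
      g h k : Carrier
      g = vertex u
      h = vertex w
      k = vertex x

  -- For y = u x⁻¹ w, the product u y⁻¹ = (u w⁻¹)(x u⁻¹) becomes x w⁻¹ when its factors are
  -- exchanged, so normality enters here. The companion identity w y⁻¹ = x u⁻¹ is plain
  -- cancellation.
  hasEdge-u·x⁻¹·wˡ : ∀ u w x → hasEdge (u·x⁻¹·w u w x) u ≡ hasEdge w x
  hasEdge-u·x⁻¹·wˡ u w x = ≡.trans (does-cong (trans (∙-congˡ (vertex-u·x⁻¹·w u w x)) (sym (assoc g _ _))))
    (≡.trans (does-∙-comm (g ∙ h ⁻¹) (k ∙ g ⁻¹)) (does-cong (begin
      k ∙ g ⁻¹ ∙ (g ∙ h ⁻¹)    ≈⟨ trans (assoc _ _ _) (∙-congˡ (sym (assoc _ _ _))) ⟩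
      k ∙ (g ⁻¹ ∙ g ∙ h ⁻¹)    ≈⟨ ∙-congˡ (trans (∙-congʳ (inverseˡ g)) (identityˡ _)) ⟩
      k ∙ h ⁻¹                 ∎)))
    where
    g h k : Carrier
    g = vertex u
    h = vertex w
    k = vertex x

  hasEdge-u·x⁻¹·wʳ : ∀ u w x → hasEdge (u·x⁻¹·w u w x) w ≡ hasEdge u x
  hasEdge-u·x⁻¹·wʳ u w x = does-cong (trans (∙-congˡ (vertex-u·x⁻¹·w u w x))
    (trans (sym (assoc _ _ _)) (trans (∙-congʳ (inverseʳ (vertex w))) (identityˡ _))))

  adjacency-normal : ∀ u w →
    ∑𝔼.sum (λ x → indicator (hasEdge u x) 𝔼.* indicator (hasEdge w x)) ≡
    ∑𝔼.sum (λ x → indicator (hasEdge x u) 𝔼.* indicator (hasEdge x w))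
  adjacency-normal u w = ≡.sym (≡.trans
    (∑𝔼.∑-permute (λ x → indicator (hasEdge x u) 𝔼.* indicator (hasEdge x w)) (u·x⁻¹·w-permutation u w))
    (∑𝔼.sum-cong-≗ (λ x → ≡.trans
      (≡.cong₂ (λ b b′ → indicator b 𝔼.* indicator b′) (hasEdge-u·x⁻¹·wˡ u w x) (hasEdge-u·x⁻¹·wʳ u w x))
      -- The substitution matches the two factors crosswise.
      (𝔼.*-comm (indicator (hasEdge w x)) (indicator (hasEdge u x))))))

theorem5p16 : ∀ {c ℓ₁ ℓ₂ a ℓ p} (K : ComplexField c ℓ₁ ℓ₂) (Γ : FiniteGroup a ℓ) (S : ConnectionSet Γ p) →
    IsNormal Γ S → EisensteinIntegral K (Cay Γ S) ⇔ HSIntegral K (Cay Γ S)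
theorem5p16 K Γ S normal = mk⇔
  (eisenstein⇒HS adjacency-normal inverse-permutation (λ u w → ≡.cong indicator (hasEdge-inverse u w)))
  (HS⇒eisenstein adjacency-normal inverse-permutation (λ u w → ≡.cong indicator (hasEdge-inverse u w)))
  where
  open NormalCayley Γ S normal
  open NormalGraph K (Cay Γ S)
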